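{- For every integer $n \ge 1$, $$\log_2 \alpha([3]^n) \le \left(1 + \frac{4\log_2 3}{n}\right) N(3,n).$$
   Context: For integers $t \ge 1$ and $n \ge 1$, $[t]^n$ denotes the poset on $\{0,1,\dots,t-1\}^n$ ordered coordinatewise: $x \preceq y$ iff $x_i \le y_i$ for all $1 \le i \le n$. Its levels are the sets of elements with a fixed coordinate sum $i$, for $i = 0,1,\dots,(t-1)n$. An antichain of a poset is a set of pairwise incomparable elements; $\alpha(P)$ denotes the number of antichains of the poset $P$, including the empty antichain. $N(t,n)$ denotes the size of a largest level of $[t]^n$, which is a middle level. -}

module Defs where

open import Data.Nat as ℕ using (ℕ; zero; suc; _+_; _*_; _⊔_)
open import Data.Fin as Fin using (Fin; toℕ)
import Data.Fin.Properties as FinP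
open import Data.Vec as Vec using (Vec; []; _∷_)
open import Data.Vec.Relation.Binary.Pointwise.Inductive as PW using (Pointwise)
open import Data.List as List using (List; []; _∷_; _++_; concatMap; length; filter; upTo; foldr)
open import Data.List.Relation.Unary.AllPairs using (AllPairs; allPairs?)
open import Data.Product using (_×_)
open import Relation.Nullary using (¬_; Dec)
open import Relation.Nullary.Decidable using (_×-dec_; ¬?)

Point : ℕ → ℕ → Set
Point t n = Vec (Fin t) n

_≼_ : ∀ {t n} → Point t n → Point t n → Set
x ≼ y = Pointwise Fin._≤_ x y

_≼?_ : ∀ {t n} (x y : Point t n) → Dec (x ≼ y)
x ≼? y = PW.decidable FinP._≤?_ x y

Incomparable : ∀ {t n} → Point t n → Point t n → Set
Incomparable x y = ¬ (x ≼ y) × ¬ (y ≼ x)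

incomparable? : ∀ {t n} (x y : Point t n) → Dec (Incomparable x y)
incomparable? x y = ¬? (x ≼? y) ×-dec ¬? (y ≼? x)

allPoints : (t n : ℕ) → List (Point t n)
allPoints t zero    = [] ∷ []
allPoints t (suc n) = concatMap (λ a → List.map (a ∷_) (allPoints t n)) (List.allFin t)

-- all sublists (= all subsets of a duplicate-free list)
sublists : ∀ {A : Set} → List A → List (List A)
sublists []       = [] ∷ []
sublists (x ∷ xs) = sublists xs ++ List.map (x ∷_) (sublists xs)

-- a finite set of points (given as a duplicate-free list) is an antichain
-- iff its elements are pairwise incomparable
IsAntichain : ∀ {t n} → List (Point t n) → Set
IsAntichain = AllPairs Incomparable

-- α([t]^n): number of antichains (including the empty one)
α : ℕ → ℕ → ℕ
α t n = length (filter (allPairs? incomparable?) (sublists (allPoints t n)))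

rank : ∀ {t n} → Point t n → ℕ
rank x = Vec.sum (Vec.map toℕ x)

levelSize : ℕ → ℕ → ℕ → ℕ
levelSize t n i = length (filter (λ x → rank x ℕ.≟ i) (allPoints t n))

N : ℕ → ℕ → ℕ
N t n = foldr _⊔_ 0 (List.map (levelSize t n) (upTo (suc ((t ℕ.∸ 1) * n))))

{-# OPTIONS --safe #-}

-- An antichain is recorded by the down-set of points not above any of its elements. These down-sets are
-- counted level by level, from the top: the number of ways to choose the levels ≥ k is at most ∏ 2^(u v),
-- over the points v of level k all of whose lower covers were chosen. For level k + 1 this bound is a product
-- of functions, one for each b, of the choice among the lower covers of b; Hölder's inequality in Finner's
-- form bounds its sum over the choices on level k by a product of sums over these small sets, which gives
-- the bound for level k. Above the middle, u v = 1 + 1 / down v, and u v = 1 + 2 / down v ≤ 1 + 4/n on the middle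
-- level n. Below it, u spreads from each b evenly over its lower covers, and the total weight ∑ u grows by at
-- most (2N/n) 2^(-i-1) on passing from level n - i to the next one. So log₂ α ≤ (1 + 6/n) N, and
-- 2^6 < 3^4. All logarithms and roots are cleared by passing to large powers.
module Submission where

open import Defs
open import Data.Nat
open import Data.Nat.Properties
open import Data.Nat.DivMod using (m/n*n≡m; m/n*n≤m)
open import Data.Nat.Divisibility using (∣-trans; m∣m*n; m≤n⇒m!∣n!)
open import Data.Nat.ListAction using (sum; product)
open import Data.Nat.Tactic.RingSolver using (solve-∀)
open import Data.Bool using (Bool; true; false; if_then_else_; not; T)
open import Data.Fin.Patterns using (0F; 1F; 2F)
import Data.Fin.Properties as Finₚ
open import Data.List as List using (List; []; _∷_; _++_; [_]; length; map; replicate; filter; filterᵇ; concatMap; allFin; foldr)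
open import Data.List.Properties using (length-++; length-map; length-replicate) renaming (∷-injective to ∷-injectiveˡʳ)
open import Data.List.Membership.Propositional using (_∈_; find; lose)
open import Data.List.Membership.Propositional.Properties
  using (∈-++⁺ˡ; ∈-++⁺ʳ; ∈-++⁻; ∈-map⁺; ∈-map⁻; ∈-filter⁺; ∈-filter⁻; ∈-∃++; ∈-concatMap⁺; ∈-allFin; ∈-upTo⁺)
open import Data.List.Relation.Unary.All as All using ([]; _∷_)
open import Data.List.Relation.Unary.AllPairs using ([]; _∷_; allPairs?)
open import Data.List.Relation.Unary.Any as Any using (Any; here; there; any?)
open import Data.List.Relation.Unary.Unique.Propositional using (Unique)
import Data.List.Relation.Unary.Unique.Propositional.Properties as Uniqueₚ
open import Data.Maybe using (Maybe; just; nothing; maybe′)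
open import Data.Product using (_×_; _,_; proj₁; proj₂)
open import Data.Sum using (inj₁; inj₂)
open import Data.Unit using (tt)
open import Data.Vec using ([]; _∷_)
open import Data.Vec.Properties using (≡-dec; ∷-injectiveˡ; ∷-injectiveʳ)
open import Data.Vec.Relation.Binary.Pointwise.Inductive as PW using ([]; _∷_)
open import Function using (_∘_; it)
open import Relation.Binary.PropositionalEquality using (_≡_; refl; sym; trans; cong; cong₂; subst; subst₂; _≗_)
open import Relation.Nullary using (¬_; Dec; does; yes; no; contradiction)
open import Relation.Nullary.Decidable using (¬?; T?; decidable-stable)
open import Relation.Unary using (Decidable)

-- For a point with d lower covers, weight u and exponent p, the local sum is (2^d - 1 + 2^(u/p))^p,
-- and everything depends on which power of 2 dominates. With p = 1 / (1 + up) above the middle, u/p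
-- is at most up + 2. From level n + 2 on this is at most d, so the local sum costs one extra bit;
-- on level n + 1 it equals d + 1, which costs two bits and gives the 2 in 1 + 2 / down on the
-- middle level. Below the middle the roles change. On level n - i, up = d + i, and with p = 1 / up
-- the second power wins by the factor 2^(i+2). Weight beyond (up + 2) / up only helps it to win, so
-- that part is set aside untouched, and the cost is at most p 2^(-i-1) bits per point. Since p ≤
-- 2/n there, these losses form a geometric series with sum at most 2/n per point of a largest
-- level; with the 4/n of the middle level this makes 6/n.

private variable
  A B I V : Set

-- Finite sums, products and powers.

∑ ∏ : List A → (A → ℕ) → ℕ
∑ xs f = sum (map f xs)
∏ xs f = product (map f xs)

⟦_⟧ : Bool → ℕ
⟦ b ⟧ = if b then 1 else 0

∑-cong : (xs : List A) {f g : A → ℕ} → f ≗ g → ∑ xs f ≡ ∑ xs g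
∑-cong []       eq = refl
∑-cong (x ∷ xs) eq = cong₂ _+_ (eq x) (∑-cong xs eq)

∏-cong : (xs : List A) {f g : A → ℕ} → f ≗ g → ∏ xs f ≡ ∏ xs g
∏-cong []       eq = refl
∏-cong (x ∷ xs) eq = cong₂ _*_ (eq x) (∏-cong xs eq)

∑-mono : (xs : List A) {f g : A → ℕ} → (∀ {x} → x ∈ xs → f x ≤ g x) → ∑ xs f ≤ ∑ xs g
∑-mono []       le = z≤n
∑-mono (x ∷ xs) le = +-mono-≤ (le (here refl)) (∑-mono xs (le ∘ there))

∏-mono : (xs : List A) {f g : A → ℕ} → (∀ {x} → x ∈ xs → f x ≤ g x) → ∏ xs f ≤ ∏ xs g
∏-mono []       le = ≤-refl
∏-mono (x ∷ xs) le = *-mono-≤ (le (here refl)) (∏-mono xs (le ∘ there))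

[m+n]+[o+p]≡[m+o]+[n+p] : ∀ m n o p → (m + n) + (o + p) ≡ (m + o) + (n + p)
[m+n]+[o+p]≡[m+o]+[n+p] = solve-∀

∑-+ : (xs : List A) (f g : A → ℕ) → ∑ xs (λ x → f x + g x) ≡ ∑ xs f + ∑ xs g
∑-+ []       f g = refl
∑-+ (x ∷ xs) f g = trans (cong (f x + g x +_) (∑-+ xs f g)) ([m+n]+[o+p]≡[m+o]+[n+p] (f x) (g x) _ _)

∏-* : (xs : List A) (f g : A → ℕ) → ∏ xs (λ x → f x * g x) ≡ ∏ xs f * ∏ xs g
∏-* []       f g = refl
∏-* (x ∷ xs) f g = trans (cong (f x * g x *_) (∏-* xs f g)) ([m*n]*[o*p]≡[m*o]*[n*p] (f x) (g x) _ _)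

∑-*ˡ : (c : ℕ) (xs : List A) (f : A → ℕ) → ∑ xs (λ x → c * f x) ≡ c * ∑ xs f
∑-*ˡ c []       f = sym (*-zeroʳ c)
∑-*ˡ c (x ∷ xs) f = trans (cong (c * f x +_) (∑-*ˡ c xs f)) (sym (*-distribˡ-+ c (f x) (∑ xs f)))

∑-zero : (xs : List A) → ∑ xs (λ _ → 0) ≡ 0
∑-zero []       = refl
∑-zero (x ∷ xs) = ∑-zero xs

∑-swap : (xs : List A) (ys : List B) (f : A → B → ℕ) →
         ∑ xs (λ x → ∑ ys (f x)) ≡ ∑ ys (λ y → ∑ xs (λ x → f x y))
∑-swap []       ys f = sym (∑-zero ys)
∑-swap (x ∷ xs) ys f = trans (cong (∑ ys (f x) +_) (∑-swap xs ys f)) (sym (∑-+ ys (f x) _))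

∑-++ : (xs ys : List A) (f : A → ℕ) → ∑ (xs ++ ys) f ≡ ∑ xs f + ∑ ys f
∑-++ []       ys f = refl
∑-++ (x ∷ xs) ys f = trans (cong (f x +_) (∑-++ xs ys f)) (sym (+-assoc (f x) _ _))

∏-++ : (xs ys : List A) (f : A → ℕ) → ∏ (xs ++ ys) f ≡ ∏ xs f * ∏ ys f
∏-++ []       ys f = sym (+-identityʳ _)
∏-++ (x ∷ xs) ys f = trans (cong (f x *_) (∏-++ xs ys f)) (sym (*-assoc (f x) _ _))

∑-map : (h : A → B) (xs : List A) (f : B → ℕ) → ∑ (map h xs) f ≡ ∑ xs (f ∘ h)
∑-map h []       f = refl
∑-map h (x ∷ xs) f = cong (f (h x) +_) (∑-map h xs f)

∏-map : (h : A → B) (xs : List A) (f : B → ℕ) → ∏ (map h xs) f ≡ ∏ xs (f ∘ h)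
∏-map h []       f = refl
∏-map h (x ∷ xs) f = cong (f (h x) *_) (∏-map h xs f)

∏-2^ : (xs : List A) (f : A → ℕ) → ∏ xs (λ x → 2 ^ f x) ≡ 2 ^ ∑ xs f
∏-2^ []       f = refl
∏-2^ (x ∷ xs) f = trans (cong (2 ^ f x *_) (∏-2^ xs f)) (sym (^-distribˡ-+-* 2 (f x) (∑ xs f)))

∑-const : (xs : List A) (c : ℕ) → ∑ xs (λ _ → c) ≡ length xs * c
∑-const []       c = refl
∑-const (x ∷ xs) c = cong (c +_) (∑-const xs c)

^-distribʳ-* : ∀ m n o → (m * n) ^ o ≡ m ^ o * n ^ o
^-distribʳ-* m n zero    = refl
^-distribʳ-* m n (suc o) = trans (cong (m * n *_) (^-distribʳ-* m n o)) ([m*n]*[o*p]≡[m*o]*[n*p] m n (m ^ o) (n ^ o))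

0^n≡0 : ∀ n .{{_ : NonZero n}} → 0 ^ n ≡ 0
0^n≡0 (suc n) = refl

^-cancelˡ-< : ∀ n {m o} → m ^ n < o ^ n → m < o
^-cancelˡ-< n lt = ≰⇒> (λ o≤m → <⇒≱ lt (^-monoˡ-≤ n o≤m))

^-cancelˡ-≤ : ∀ n .{{_ : NonZero n}} {m o} → m ^ n ≤ o ^ n → m ≤ o
^-cancelˡ-≤ n le = ≮⇒≥ (λ o<m → <⇒≱ (^-monoˡ-< n o<m) le)

-- The inequality between the arithmetic and geometric means.

2*m*n≤m²+n² : ∀ m n → 2 * m * n ≤ m * m + n * n
2*m*n≤m²+n² m n with ≤-total m n
... | inj₁ m≤n = subst (λ n → 2 * m * n ≤ m * m + n * n) (m+[n∸m]≡n m≤n)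
                   (subst (2 * m * (m + (n ∸ m)) ≤_) (sym (id₁ m (n ∸ m))) (m≤m+n _ _))
  where
  id₁ : ∀ m k → m * m + (m + k) * (m + k) ≡ 2 * m * (m + k) + k * k
  id₁ = solve-∀
... | inj₂ n≤m = subst (λ m → 2 * m * n ≤ m * m + n * n) (m+[n∸m]≡n n≤m)
                   (subst (2 * (n + (m ∸ n)) * n ≤_) (sym (id₂ n (m ∸ n))) (m≤m+n _ _))
  where
  id₂ : ∀ n k → (n + k) * (n + k) + n * n ≡ 2 * (n + k) * n + k * k
  id₂ = solve-∀

-- AM-GM for m copies of p^(m+1) and one q^(m+1). In the induction, m p^(m+1) q is added to both
-- sides, so that the left side becomes a multiple of 2pq, which p² + q² dominates.
young : ∀ m p q → suc m * p ^ m * q ≤ m * p ^ suc m + q ^ suc m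
young zero    p q = ≤-reflexive (e q)
  where
  e : ∀ q → 1 * 1 * q ≡ 0 + q * 1
  e = solve-∀
young (suc m) p q = +-cancelʳ-≤ (m * (p * P) * q) _ _ (begin
  suc (suc m) * (p * P) * q + m * (p * P) * q     ≡⟨ e₁ m p q P ⟩
  suc m * P * (2 * p * q)                          ≤⟨ *-monoʳ-≤ (suc m * P) (2*m*n≤m²+n² p q) ⟩
  suc m * P * (p * p + q * q)                      ≡⟨ e₂ m p q P ⟩
  suc m * (p * (p * P)) + suc m * P * q * q        ≤⟨ +-monoʳ-≤ (suc m * (p * (p * P))) (*-monoˡ-≤ q (young m p q)) ⟩
  suc m * (p * (p * P)) + (m * (p * P) + Q) * q    ≡⟨ e₃ m p q P Q ⟩
  suc m * (p * (p * P)) + q * Q + m * (p * P) * q  ∎)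
  where
  open ≤-Reasoning
  P = p ^ m
  Q = q ^ suc m
  e₁ : ∀ m p q P → suc (suc m) * (p * P) * q + m * (p * P) * q ≡ suc m * P * (2 * p * q)
  e₁ = solve-∀
  e₂ : ∀ m p q P → suc m * P * (p * p + q * q) ≡ suc m * (p * (p * P)) + suc m * P * q * q
  e₂ = solve-∀
  e₃ : ∀ m p q P Q → suc m * (p * (p * P)) + (m * (p * P) + Q) * q ≡ suc m * (p * (p * P)) + q * Q + m * (p * P) * q
  e₃ = solve-∀

-- The quotient of AM-GM for m + 1 numbers by AM-GM for m numbers with sum s. It is `young` at p =
-- (m + 1) s and q = m (s + x), which agree exactly in the equality case, when x is the mean s / m.
amgm-step : ∀ m s x → suc m ^ suc m * s ^ m * x ≤ m ^ m * (s + x) ^ suc m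
amgm-step zero s x = subst₂ _≤_ (e₁ x) (e₂ s x) (m≤n+m x s)
  where
  e₁ : ∀ x → x ≡ 1 * 1 * 1 * x
  e₁ = solve-∀
  e₂ : ∀ s x → s + x ≡ 1 * ((s + x) * 1)
  e₂ = solve-∀
amgm-step m@(suc _) s x = *-cancelˡ-≤ m (+-cancelʳ-≤ (m * (suc m * s * (K * S))) _ _ (begin
  m * (suc m * K * S * x) + m * (suc m * s * (K * S))    ≡⟨ e₁ m s x K S ⟩
  suc m * (K * S) * (m * (s + x))                        ≡⟨ cong (λ z → suc m * z * (m * (s + x))) (sym (^-distribʳ-* (suc m) s m)) ⟩
  suc m * (suc m * s) ^ m * (m * (s + x))                ≤⟨ young m (suc m * s) (m * (s + x)) ⟩
  m * (suc m * s * (suc m * s) ^ m) + (m * (s + x)) ^ suc m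
    ≡⟨ cong₂ (λ y z → m * (suc m * s * y) + z) (^-distribʳ-* (suc m) s m) (^-distribʳ-* m (s + x) (suc m)) ⟩
  m * (suc m * s * (K * S)) + m * m ^ m * Z              ≡⟨ e₂ m (suc m * s * (K * S)) (m ^ m) Z ⟩
  m * (m ^ m * Z) + m * (suc m * s * (K * S))            ∎))
  where
  open ≤-Reasoning
  K = suc m ^ m
  S = s ^ m
  Z = (s + x) ^ suc m
  e₁ : ∀ m s x K S → m * (suc m * K * S * x) + m * (suc m * s * (K * S)) ≡ suc m * (K * S) * (m * (s + x))
  e₁ = solve-∀
  e₂ : ∀ m y k z → m * y + m * k * z ≡ m * (k * z) + m * y
  e₂ = solve-∀

m^m≢0 : ∀ m → NonZero (m ^ m)
m^m≢0 zero      = _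
m^m≢0 m@(suc _) = m^n≢0 m m

amgm : ∀ as → length as ^ length as * product as ≤ sum as ^ length as
amgm []       = ≤-refl
amgm (a ∷ as) = *-cancelˡ-≤ (m ^ m) {{m^m≢0 m}} (begin
  m ^ m * (suc m ^ suc m * (a * product as))   ≡⟨ e₁ (m ^ m) (suc m ^ suc m) a (product as) ⟩
  suc m ^ suc m * (m ^ m * product as) * a     ≤⟨ *-monoˡ-≤ a (*-monoʳ-≤ (suc m ^ suc m) (amgm as)) ⟩
  suc m ^ suc m * sum as ^ m * a               ≤⟨ amgm-step m (sum as) a ⟩
  m ^ m * (sum as + a) ^ suc m                 ≡⟨ cong (λ z → m ^ m * z ^ suc m) (+-comm (sum as) a) ⟩
  m ^ m * (a + sum as) ^ suc m                 ∎)
  where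
  open ≤-Reasoning
  m = length as
  e₁ : ∀ k l a p → k * (l * (a * p)) ≡ l * (k * p) * a
  e₁ = solve-∀

-- Superadditivity of the geometric mean.

-- The j-th entry is f j · ∏ g over the other entries, so that entry j stands for the ratio f j / g j.
cofactors : (f g : A → ℕ) → List A → List ℕ
cofactors f g []       = []
cofactors f g (x ∷ xs) = f x * ∏ xs g ∷ map (g x *_) (cofactors f g xs)

length-cofactors : (f g : A → ℕ) (xs : List A) → length (cofactors f g xs) ≡ length xs
length-cofactors f g []       = refl
length-cofactors f g (x ∷ xs) = cong suc (trans (length-map (g x *_) (cofactors f g xs)) (length-cofactors f g xs))

product-map-* : ∀ c as → product (map (c *_) as) ≡ c ^ length as * product as
product-map-* c []       = refl
product-map-* c (a ∷ as) = trans (cong (c * a *_) (product-map-* c as)) ([m*n]*[o*p]≡[m*o]*[n*p] c a (c ^ length as) (product as))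

sum-map-* : ∀ c as → sum (map (c *_) as) ≡ c * sum as
sum-map-* c []       = sym (*-zeroʳ c)
sum-map-* c (a ∷ as) = trans (cong (c * a +_) (sum-map-* c as)) (sym (*-distribˡ-+ c a (sum as)))

product-cofactors : (f g : A → ℕ) (xs : List A) →
  ∏ xs g * product (cofactors f g xs) ≡ ∏ xs f * ∏ xs g ^ length xs
product-cofactors f g []       = refl
product-cofactors f g (x ∷ xs) = begin-equality
  c * P * (a * P * product (map (c *_) cs))       ≡⟨ cong (λ z → c * P * (a * P * z)) (product-map-* c cs) ⟩
  c * P * (a * P * (c ^ length cs * product cs))  ≡⟨ cong (λ z → c * P * (a * P * (c ^ z * product cs))) (length-cofactors f g xs) ⟩
  c * P * (a * P * (c ^ m * product cs))          ≡⟨ e₁ c P a (c ^ m) (product cs) ⟩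
  c * P * a * (c ^ m * (P * product cs))          ≡⟨ cong (λ z → c * P * a * (c ^ m * z)) (product-cofactors f g xs) ⟩
  c * P * a * (c ^ m * (∏ xs f * P ^ m))          ≡⟨ e₂ c P a (c ^ m) (∏ xs f) (P ^ m) ⟩
  a * ∏ xs f * (c * P * (c ^ m * P ^ m))          ≡⟨ cong (λ z → a * ∏ xs f * (c * P * z)) (sym (^-distribʳ-* c P m)) ⟩
  a * ∏ xs f * (c * P * (c * P) ^ m)              ∎
  where
  open ≤-Reasoning
  a = f x
  c = g x
  P = ∏ xs g
  cs = cofactors f g xs
  m = length xs
  e₁ : ∀ c P a k p → c * P * (a * P * (k * p)) ≡ c * P * a * (k * (P * p))
  e₁ = solve-∀
  e₂ : ∀ c P a k p q → c * P * a * (k * (p * q)) ≡ a * p * (c * P * (k * q))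
  e₂ = solve-∀

-- At each index the ratios f / h and g / h add up to 1.
sum-cofactors-+ : (f g h : A → ℕ) (xs : List A) → (∀ x → h x ≡ f x + g x) →
  sum (cofactors f h xs) + sum (cofactors g h xs) ≡ length xs * ∏ xs h
sum-cofactors-+ f g h []       eq = refl
sum-cofactors-+ f g h (x ∷ xs) eq = begin-equality
  (f x * P + sum (map (h x *_) fs)) + (g x * P + sum (map (h x *_) gs))
    ≡⟨ cong₂ (λ y z → (f x * P + y) + (g x * P + z)) (sum-map-* (h x) fs) (sum-map-* (h x) gs) ⟩
  (f x * P + h x * sum fs) + (g x * P + h x * sum gs)   ≡⟨ e₁ (f x) (g x) (h x) P (sum fs) (sum gs) ⟩
  (f x + g x) * P + h x * (sum fs + sum gs)             ≡⟨ cong₂ (λ y z → y * P + h x * z) (sym (eq x)) (sum-cofactors-+ f g h xs eq) ⟩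
  h x * P + h x * (length xs * P)                       ≡⟨ e₂ (h x) P (length xs) ⟩
  suc (length xs) * (h x * P)                           ∎
  where
  open ≤-Reasoning
  P = ∏ xs h
  fs = cofactors f h xs
  gs = cofactors g h xs
  e₁ : ∀ a b c P s t → (a * P + c * s) + (b * P + c * t) ≡ (a + b) * P + c * (s + t)
  e₁ = solve-∀
  e₂ : ∀ c P m → c * P + c * (m * P) ≡ suc m * (c * P)
  e₂ = solve-∀

-- AM-GM for the ratios f j / h j.
amgm-cofactors : (f h : A → ℕ) (xs : List A) →
  (length xs * ∏ xs h) ^ length xs * ∏ xs f ≤ sum (cofactors f h xs) ^ length xs * ∏ xs h
amgm-cofactors f h xs = begin
  (m * P) ^ m * ∏ xs f               ≡⟨ cong (_* ∏ xs f) (^-distribʳ-* m P m) ⟩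
  m ^ m * P ^ m * ∏ xs f             ≡⟨ e₁ (m ^ m) (P ^ m) (∏ xs f) ⟩
  m ^ m * (∏ xs f * P ^ m)           ≡⟨ cong (m ^ m *_) (sym (product-cofactors f h xs)) ⟩
  m ^ m * (P * product cs)           ≡⟨ e₂ (m ^ m) P (product cs) ⟩
  m ^ m * product cs * P             ≤⟨ *-monoˡ-≤ P (subst (λ k → k ^ k * product cs ≤ sum cs ^ k) (length-cofactors f h xs) (amgm cs)) ⟩
  sum cs ^ m * P                     ∎
  where
  open ≤-Reasoning
  m = length xs
  P = ∏ xs h
  cs = cofactors f h xs
  e₁ : ∀ a b c → a * b * c ≡ a * (c * b)
  e₁ = solve-∀
  e₂ : ∀ a b c → a * (b * c) ≡ a * c * b
  e₂ = solve-∀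

module _ (xs : List A) (f g : A → ℕ) (C R : ℕ) .{{_ : NonZero R}} (R≤ : R ≤ length xs) where
  private
    h : A → ℕ
    h x = f x + g x
    m = length xs
    P = ∏ xs h

    instance
      m≢0 : NonZero m
      m≢0 = >-nonZero (<-≤-trans (>-nonZero⁻¹ R) R≤)

    -- One summand in an argument by contradiction: `lt` negates the conclusion, with t = x + y.
    -- Then (x/t)^m ≤ (x/t)^R ≤ C ∏ e / t^R, where C / t^R is less than 1 / P, and AM-GM bounds x/t
    -- by the mean S / (m P) of the ratios e / h, strictly unless S = 0.
    module Side (e : A → ℕ) (x t : ℕ) (x≤t : x ≤ t) (lt : C * P < t ^ R) (hyp : x ^ R ≤ C * ∏ xs e) where
      S = sum (cofactors e h xs)

      -- As x/t is at most 1, its m-th power is at most its R-th; `R≤` enters here.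
      x^m*t^R≤x^R*t^m : x ^ m * t ^ R ≤ x ^ R * t ^ m
      x^m*t^R≤x^R*t^m = begin
        x ^ m * t ^ R                    ≡⟨ cong (λ k → x ^ k * t ^ R) (sym (m+[n∸m]≡n R≤)) ⟩
        x ^ (R + (m ∸ R)) * t ^ R        ≡⟨ cong (_* t ^ R) (^-distribˡ-+-* x R (m ∸ R)) ⟩
        x ^ R * x ^ (m ∸ R) * t ^ R      ≤⟨ *-monoˡ-≤ (t ^ R) (*-monoʳ-≤ (x ^ R) (^-monoˡ-≤ (m ∸ R) x≤t)) ⟩
        x ^ R * t ^ (m ∸ R) * t ^ R      ≡⟨ e₁ (x ^ R) (t ^ (m ∸ R)) (t ^ R) ⟩
        x ^ R * (t ^ R * t ^ (m ∸ R))    ≡⟨ cong (x ^ R *_) (sym (^-distribˡ-+-* t R (m ∸ R))) ⟩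
        x ^ R * t ^ (R + (m ∸ R))        ≡⟨ cong (λ k → x ^ R * t ^ k) (m+[n∸m]≡n R≤) ⟩
        x ^ R * t ^ m                    ∎
        where
        open ≤-Reasoning
        e₁ : ∀ a b c → a * b * c ≡ a * (c * b)
        e₁ = solve-∀

      main : (m * P * x) ^ m * t ^ R ≤ (S * t) ^ m * (C * P)
      main = begin
        (m * P * x) ^ m * t ^ R               ≡⟨ cong (_* t ^ R) (^-distribʳ-* (m * P) x m) ⟩
        (m * P) ^ m * x ^ m * t ^ R           ≡⟨ *-assoc ((m * P) ^ m) _ _ ⟩
        (m * P) ^ m * (x ^ m * t ^ R)         ≤⟨ *-monoʳ-≤ ((m * P) ^ m) x^m*t^R≤x^R*t^m ⟩
        (m * P) ^ m * (x ^ R * t ^ m)         ≤⟨ *-monoʳ-≤ ((m * P) ^ m) (*-monoˡ-≤ (t ^ m) hyp) ⟩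
        (m * P) ^ m * (C * ∏ xs e * t ^ m)    ≡⟨ e₁ ((m * P) ^ m) C (∏ xs e) (t ^ m) ⟩
        (m * P) ^ m * ∏ xs e * (t ^ m * C)    ≤⟨ *-monoˡ-≤ (t ^ m * C) (amgm-cofactors e h xs) ⟩
        S ^ m * P * (t ^ m * C)               ≡⟨ e₂ (S ^ m) P (t ^ m) C ⟩
        S ^ m * t ^ m * (C * P)               ≡⟨ cong (_* (C * P)) (sym (^-distribʳ-* S t m)) ⟩
        (S * t) ^ m * (C * P)                 ∎
        where
        open ≤-Reasoning
        e₁ : ∀ a b c d → a * (b * c * d) ≡ a * c * (d * b)
        e₁ = solve-∀
        e₂ : ∀ a b c d → a * b * (c * d) ≡ a * c * (d * b)
        e₂ = solve-∀

      t>0 : 0 < t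
      t>0 = n≢0⇒n>0 (λ { refl → n≮0 (subst (C * P <_) (0^n≡0 R) lt) })

      strict : 0 < S → m * P * x < S * t
      strict S>0 = ^-cancelˡ-< m (*-cancelʳ-< (t ^ R) _ _ (≤-<-trans main
        (*-monoʳ-< ((S * t) ^ m) {{m^n≢0 (S * t) m {{>-nonZero (*-mono-≤ S>0 t>0)}}}} lt)))

      weak : m * P * x ≤ S * t
      weak with S ≟ 0
      ... | no S≢0  = <⇒≤ (strict (n≢0⇒n>0 S≢0))
      ... | yes S≡0 = ≤-trans (≤-reflexive (m^n≡0⇒m≡0 _ m (n≤0⇒n≡0 (*-cancelʳ-≤ _ 0 (t ^ R) {{m^n≢0 t R {{>-nonZero t>0}}}} le)))) z≤n
        where
        le : (m * P * x) ^ m * t ^ R ≤ 0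
        le = ≤-trans main (≤-reflexive (trans (cong (λ s → (s * t) ^ m * (C * P)) S≡0) (cong (_* (C * P)) (0^n≡0 m))))

  -- Superadditivity of the geometric mean, with the roots cleared.
  geometric-mean-superadditive : ∀ x y → x ^ R ≤ C * ∏ xs f → y ^ R ≤ C * ∏ xs g →
    (x + y) ^ R ≤ C * ∏ xs (λ i → f i + g i)
  -- The two bounds add up to x/t + y/t < 1, because the mean ratios of f / h and g / h have sum 1.
  geometric-mean-superadditive x y hx hy = ≮⇒≥ λ lt →
    let module X = Side f x (x + y) (m≤m+n x y) lt hx
        module Y = Side g y (x + y) (m≤n+m y x) lt hy
        S+S≡ = sum-cofactors-+ f g h xs (λ _ → refl)
        total : m * P * x + m * P * y ≡ X.S * (x + y) + Y.S * (x + y)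
        total = trans (sym (*-distribˡ-+ (m * P) x y))
                  (trans (cong (_* (x + y)) (sym S+S≡)) (*-distribʳ-+ (x + y) X.S Y.S))
    in case (X.S ≟ 0) (Y.S ≟ 0) X.strict X.weak Y.strict Y.weak S+S≡ total lt
    where
    base≡0 : ∀ {k z} → k ≤ 0 → z ^ R ≤ C * k → z ≡ 0
    base≡0 k≤0 le = m^n≡0⇒m≡0 _ R (n≤0⇒n≡0 (≤-trans le (≤-trans (*-monoʳ-≤ C k≤0) (≤-reflexive (*-zeroʳ C)))))
    case : ∀ {s s′} → Dec (s ≡ 0) → Dec (s′ ≡ 0) →
           (0 < s → m * P * x < s * (x + y)) → m * P * x ≤ s * (x + y) →
           (0 < s′ → m * P * y < s′ * (x + y)) → m * P * y ≤ s′ * (x + y) →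
           s + s′ ≡ m * P → m * P * x + m * P * y ≡ s * (x + y) + s′ * (x + y) → ¬ C * P < (x + y) ^ R
    case (no s≢0) _ st _ _ wk _ tot _ = <⇒≢ (+-mono-<-≤ (st (n≢0⇒n>0 s≢0)) wk) tot
    case (yes _) (no s≢0) _ wk st _ _ tot _ = <⇒≢ (+-mono-≤-< wk (st (n≢0⇒n>0 s≢0))) tot
    -- If both ratio sums vanish then P = 0, so the hypotheses force x = y = 0 and `lt` would put a
    -- number below 0.
    case (yes refl) (yes refl) _ _ _ _ 0≡mP _ lt =
      n≮0 (<-≤-trans lt (≤-reflexive (trans (cong₂ (λ a b → (a + b) ^ R) x≡0 y≡0) (0^n≡0 R))))
      where
      P≤0 : P ≤ 0
      P≤0 = ≤-reflexive (m*n≡0⇒m≡0 P m (trans (*-comm P m) (sym 0≡mP)))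
      x≡0 = base≡0 (≤-trans (∏-mono xs (λ _ → m≤m+n _ _)) P≤0) hx
      y≡0 = base≡0 (≤-trans (∏-mono xs (λ _ → m≤n+m _ _)) P≤0) hy

-- Finner's inequality.

expand : (A → ℕ) → List A → List A
expand w = concatMap (λ x → replicate (w x) x)

length-expand : (w : A → ℕ) (xs : List A) → length (expand w xs) ≡ ∑ xs w
length-expand w []       = refl
length-expand w (x ∷ xs) = trans (length-++ (replicate (w x) x))
  (cong₂ _+_ (length-replicate (w x)) (length-expand w xs))

∏-replicate : (k : ℕ) (x : A) (f : A → ℕ) → ∏ (replicate k x) f ≡ f x ^ k
∏-replicate zero    x f = refl
∏-replicate (suc k) x f = cong (f x *_) (∏-replicate k x f)

∏-expand : (w : A → ℕ) (xs : List A) (f : A → ℕ) → ∏ (expand w xs) f ≡ ∏ xs (λ x → f x ^ w x)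
∏-expand w []       f = refl
∏-expand w (x ∷ xs) f = trans (∏-++ (replicate (w x) x) _ f)
  (cong₂ _*_ (∏-replicate (w x) x f) (∏-expand w xs f))

-- An integer weight is a number of repetitions in the unweighted statement. The additional index
-- `nothing`, repeated s times with both functions equal to 1, tops the total weight up to R and
-- contributes (1 + 1)^s.
weighted-superadditive : (is : List I) (f g w : I → ℕ) (s C R : ℕ) .{{_ : NonZero R}} →
  R ≤ s + ∑ is w → ∀ x y →
  x ^ R ≤ C * ∏ is (λ i → f i ^ w i) → y ^ R ≤ C * ∏ is (λ i → g i ^ w i) →
  (x + y) ^ R ≤ C * (2 ^ s * ∏ is (λ i → (f i + g i) ^ w i))
weighted-superadditive {I} is f g w s C R R≤ x y hx hy = begin
  (x + y) ^ R
    ≤⟨ geometric-mean-superadditive slots f′ g′ C R (≤-trans R≤ (≤-reflexive (sym len))) x y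
         (≤-trans hx (≤-reflexive (cong (C *_) (sym (prod f′ (^-zeroˡ s))))))
         (≤-trans hy (≤-reflexive (cong (C *_) (sym (prod g′ (^-zeroˡ s)))))) ⟩
  C * ∏ slots (λ j → f′ j + g′ j)                      ≡⟨ cong (C *_) (∏-expand w′ is′ _) ⟩
  C * (2 ^ s * ∏ (map just is) (λ j → (f′ j + g′ j) ^ w′ j))
    ≡⟨ cong (λ z → C * (2 ^ s * z)) (∏-map just is _) ⟩
  C * (2 ^ s * ∏ is (λ i → (f i + g i) ^ w i))         ∎
  where
  open ≤-Reasoning
  is′ : List (Maybe I)
  is′ = nothing ∷ map just is
  f′ g′ w′ : Maybe I → ℕ
  f′ = maybe′ f 1
  g′ = maybe′ g 1
  w′ = maybe′ w s
  slots = expand w′ is′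
  len : length slots ≡ s + ∑ is w
  len = trans (length-expand w′ is′) (cong (s +_) (∑-map just is w′))
  prod : (e : Maybe I → ℕ) → e nothing ^ s ≡ 1 → ∏ slots e ≡ ∏ is (λ i → e (just i) ^ w i)
  prod e e≡1 = trans (∏-expand w′ is′ e)
    (trans (cong₂ _*_ e≡1 (∏-map just is _)) (+-identityʳ _))

module _ (mem : I → V → Bool) (is : List I) (r : I → ℕ) (s : V → ℕ) (R : ℕ) .{{_ : NonZero R}} where
  private
    local-sum : (V → Bool) → List V → (List V → ℕ) → ℕ
    local-sum p xs = ∑ (sublists (filterᵇ p xs))

    -- The family left once x is fixed as chosen. An index that does not see x keeps its function,
    -- so its local sum is the same whether x is chosen or not.
    slice : V → (I → List V → ℕ) → I → List V → ℕ
    slice x G i t = if mem i x then G i (x ∷ t) else G i t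

    merge : ∀ b r a c u → (b ≡ true → u ≡ a + c) → (b ≡ false → u ≡ a) →
            (a + c) ^ (⟦ b ⟧ * r) * a ^ (⟦ not b ⟧ * r) ≡ u ^ r
    merge true  r a c u eq _ = trans (*-identityʳ _) (cong₂ _^_ (sym (eq refl)) (+-identityʳ r))
    merge false r a c u _ eq = trans (+-identityʳ _) (cong₂ _^_ (sym (eq refl)) (+-identityʳ r))

    split : ∀ b r a → a ^ r ≡ a ^ (⟦ not b ⟧ * r) * a ^ (⟦ b ⟧ * r)
    split true  r a = trans (cong (a ^_) (sym (+-identityʳ r))) (sym (+-identityʳ _))
    split false r a = trans (cong (a ^_) (sym (+-identityʳ r))) (sym (*-identityʳ _))

    slice-true : ∀ (G : I → List V → ℕ) x xs i → mem i x ≡ true →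
      local-sum (mem i) (x ∷ xs) (G i) ≡ local-sum (mem i) xs (G i) + local-sum (mem i) xs (slice x G i)
    slice-true G x xs i eq rewrite eq =
      trans (∑-++ (sublists ys) _ (G i)) (cong (∑ (sublists ys) (G i) +_) (∑-map (x ∷_) (sublists ys) (G i)))
      where ys = filterᵇ (mem i) xs

    slice-false : ∀ (G : I → List V → ℕ) x xs i → mem i x ≡ false →
      local-sum (mem i) (x ∷ xs) (G i) ≡ local-sum (mem i) xs (G i)
    slice-false G x xs i eq rewrite eq = refl

    slice-false′ : ∀ (G : I → List V → ℕ) x xs i → mem i x ≡ false →
      local-sum (mem i) xs (slice x G i) ≡ local-sum (mem i) xs (G i)
    slice-false′ G x xs i eq rewrite eq = refl

    slice-filter : ∀ (G : I → List V → ℕ) x t i → G i (filterᵇ (mem i) (x ∷ t)) ≡ slice x G i (filterᵇ (mem i) t)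
    slice-filter G x t i with mem i x
    ... | true  = refl
    ... | false = refl

  -- Finner's form of Hölder's inequality on the cube of sublists of xs: the function G i only sees the
  -- coordinates in mem i and has exponent r i / R; s is the weight of the one-point functions.
  finner : (xs : List V) → (∀ {x} → x ∈ xs → R ≤ s x + ∑ is (λ i → ⟦ mem i x ⟧ * r i)) →
    (C : ℕ) (F : List V → ℕ) (G : I → List V → ℕ) →
    (∀ {t} → t ∈ sublists xs → F t ^ R ≤ C * ∏ is (λ i → G i (filterᵇ (mem i) t) ^ r i)) →
    ∑ (sublists xs) F ^ R ≤ C * (2 ^ ∑ xs s * ∏ is (λ i → ∑ (sublists (filterᵇ (mem i) xs)) (G i) ^ r i))
  finner [] cover C F G hyp = begin
    (F [] + 0) ^ R                             ≡⟨ cong (_^ R) (+-identityʳ (F [])) ⟩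
    F [] ^ R                                   ≤⟨ hyp (here refl) ⟩
    C * ∏ is (λ i → G i [] ^ r i)              ≡⟨ cong (C *_) (∏-cong is (λ i → cong (_^ r i) (sym (+-identityʳ (G i []))))) ⟩
    C * ∏ is (λ i → (G i [] + 0) ^ r i)        ≡⟨ cong (C *_) (sym (+-identityʳ _)) ⟩
    C * (1 * ∏ is (λ i → (G i [] + 0) ^ r i))  ∎
    where open ≤-Reasoning
  finner (x ∷ xs) cover C F G hyp = begin
    ∑ (sublists xs ++ map (x ∷_) (sublists xs)) F ^ R
      ≡⟨ cong (_^ R) (trans (∑-++ (sublists xs) _ F) (cong (∑ (sublists xs) F +_) (∑-map (x ∷_) (sublists xs) F))) ⟩
    (∑ (sublists xs) F + ∑ (sublists xs) (F ∘ (x ∷_))) ^ R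
      -- The lists without x and those with x each fall under the induction hypothesis. The indices
      -- that do not see x give the same factor K in both; it is moved into the constant `C′`, and
      -- only the indices that see x take part in superadditivity.
      ≤⟨ weighted-superadditive is S S′ (λ i → ⟦ mem i x ⟧ * r i) (s x) C′ R (cover (here refl)) _ _
           (≤-trans (finner xs (cover ∘ there) C F G (hyp ∘ ∈-++⁺ˡ))
              (≤-reflexive (regroup S (λ i _ → refl))))
           (≤-trans (finner xs (cover ∘ there) C (F ∘ (x ∷_)) (slice x G) hyp′)
              (≤-reflexive (regroup S′ (λ i eq → slice-false′ G x xs i eq)))) ⟩
    C′ * (2 ^ s x * ∏ is (λ i → (S i + S′ i) ^ (⟦ mem i x ⟧ * r i)))
      ≡⟨ e₁ C (2 ^ ∑ xs s) K (2 ^ s x) _ ⟩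
    C * (2 ^ s x * 2 ^ ∑ xs s * (∏ is (λ i → (S i + S′ i) ^ (⟦ mem i x ⟧ * r i)) * K))
      ≡⟨ cong₂ (λ y z → C * (y * z)) (sym (^-distribˡ-+-* 2 (s x) (∑ xs s)))
           (trans (sym (∏-* is _ _)) (∏-cong is (λ i → merge (mem i x) (r i) (S i) (S′ i) _
             (slice-true G x xs i) (slice-false G x xs i)))) ⟩
    C * (2 ^ ∑ (x ∷ xs) s * ∏ is (λ i → local-sum (mem i) (x ∷ xs) (G i) ^ r i)) ∎
    where
    open ≤-Reasoning
    S S′ : I → ℕ
    S i  = local-sum (mem i) xs (G i)
    S′ i = local-sum (mem i) xs (slice x G i)
    K = ∏ is (λ i → S i ^ (⟦ not (mem i x) ⟧ * r i))
    C′ = C * (2 ^ ∑ xs s * K)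
    e₁ : ∀ C a K b P → C * (a * K) * (b * P) ≡ C * (b * a * (P * K))
    e₁ = solve-∀
    e₂ : ∀ C a K P → C * (a * (K * P)) ≡ C * (a * K) * P
    e₂ = solve-∀
    hyp′ : ∀ {t} → t ∈ sublists xs → F (x ∷ t) ^ R ≤ C * ∏ is (λ i → slice x G i (filterᵇ (mem i) t) ^ r i)
    hyp′ {t} t∈ = ≤-trans (hyp (∈-++⁺ʳ (sublists xs) (∈-map⁺ (x ∷_) t∈)))
      (≤-reflexive (cong (C *_) (∏-cong is (λ i → cong (_^ r i) (slice-filter G x t i)))))
    off : ∀ b r a c → (b ≡ false → a ≡ c) → a ^ (⟦ not b ⟧ * r) ≡ c ^ (⟦ not b ⟧ * r)
    off true  r a c eq = refl
    off false r a c eq = cong (_^ (1 * r)) (eq refl)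
    regroup : (H : I → ℕ) → (∀ i → mem i x ≡ false → H i ≡ S i) →
      C * (2 ^ ∑ xs s * ∏ is (λ i → H i ^ r i)) ≡ C′ * ∏ is (λ i → H i ^ (⟦ mem i x ⟧ * r i))
    regroup H eq = trans (cong (λ z → C * (2 ^ ∑ xs s * z))
      (trans (∏-cong is (λ i → split (mem i x) (r i) (H i)))
        (trans (∏-* is _ _) (cong (_* ∏ is (λ i → H i ^ (⟦ mem i x ⟧ * r i)))
          (∏-cong is (λ i → off (mem i x) (r i) (H i) (S i) (eq i)))))))
      (e₂ C (2 ^ ∑ xs s) K _)

-- Summing out one level.

∑-filterᵇ : (p : A → Bool) (xs : List A) (f : A → ℕ) → ∑ (filterᵇ p xs) f ≡ ∑ xs (λ x → ⟦ p x ⟧ * f x)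
∑-filterᵇ p []       f = refl
∑-filterᵇ p (x ∷ xs) f with p x
... | true  = cong₂ _+_ (sym (+-identityʳ (f x))) (∑-filterᵇ p xs f)
... | false = ∑-filterᵇ p xs f

length≡∑1 : (xs : List A) → length xs ≡ ∑ xs (λ _ → 1)
length≡∑1 []       = refl
length≡∑1 (x ∷ xs) = cong suc (length≡∑1 xs)

length-filterᵇ : (p : A → Bool) (xs : List A) → length (filterᵇ p xs) ≡ ∑ xs (λ x → ⟦ p x ⟧)
length-filterᵇ p xs = trans (length≡∑1 (filterᵇ p xs))
  (trans (∑-filterᵇ p xs (λ _ → 1)) (∑-cong xs (λ x → *-identityʳ ⟦ p x ⟧)))

∑-sublists : (xs : List A) {t : List A} → t ∈ sublists xs → (f : A → ℕ) → ∑ t f ≤ ∑ xs f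
∑-sublists []       (here refl) f = z≤n
∑-sublists (x ∷ xs) t∈ f with ∈-++⁻ (sublists xs) t∈
... | inj₁ t∈xs = ≤-trans (∑-sublists xs t∈xs f) (m≤n+m _ (f x))
... | inj₂ t∈x∷ with ∈-map⁻ (x ∷_) t∈x∷
...   | t′ , t′∈ , refl = +-monoʳ-≤ (f x) (∑-sublists xs t′∈ f)

length-filterᵇ-sublists : (p : A → Bool) (xs : List A) {t : List A} → t ∈ sublists xs →
  length (filterᵇ p t) ≤ length (filterᵇ p xs)
length-filterᵇ-sublists p xs {t} t∈ = subst₂ _≤_ (sym (length-filterᵇ p t)) (sym (length-filterᵇ p xs))
  (∑-sublists xs t∈ (λ x → ⟦ p x ⟧))

≡ᵇ-refl : ∀ n → (n ≡ᵇ n) ≡ true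
≡ᵇ-refl zero    = refl
≡ᵇ-refl (suc n) = ≡ᵇ-refl n

≡ᵇ-true⇒≡ : ∀ m n → (m ≡ᵇ n) ≡ true → m ≡ n
≡ᵇ-true⇒≡ m n eq = ≡ᵇ⇒≡ m n (subst T (sym eq) tt)

<⇒≡ᵇ-false : ∀ {m n} → m < n → (m ≡ᵇ n) ≡ false
<⇒≡ᵇ-false {m} {n} m<n with m ≡ᵇ n in eq
... | true  = contradiction (≡ᵇ-true⇒≡ m n eq) (<⇒≢ m<n)
... | false = refl

-- Only `ys` itself can have length d, so at most one term is b. In that case the exact value is 2^d
-- - 1 + b; the -1 is given away to avoid subtraction.
∑-sublists-bonus : (ys : List A) (d b : ℕ) → length ys ≤ d →
  ∑ (sublists ys) (λ t → if length t ≡ᵇ d then b else 1) ≤ 2 ^ length ys + ⟦ length ys ≡ᵇ d ⟧ * b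
∑-sublists-bonus []       zero    b _ = n≤1+n _
∑-sublists-bonus []       (suc d) b _ = ≤-refl
∑-sublists-bonus (y ∷ ys) (suc d) b (s≤s ℓ≤d) = begin
  ∑ (sublists ys ++ map (y ∷_) (sublists ys)) bonus
    ≡⟨ trans (∑-++ (sublists ys) _ bonus) (cong (∑ (sublists ys) bonus +_) (∑-map (y ∷_) (sublists ys) bonus)) ⟩
  ∑ (sublists ys) bonus + ∑ (sublists ys) (λ t → if length t ≡ᵇ d then b else 1)
    ≤⟨ +-mono-≤ (∑-sublists-bonus ys (suc d) b (m≤n⇒m≤1+n ℓ≤d)) (∑-sublists-bonus ys d b ℓ≤d) ⟩
  (2 ^ ℓ + ⟦ ℓ ≡ᵇ suc d ⟧ * b) + (2 ^ ℓ + ⟦ ℓ ≡ᵇ d ⟧ * b)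
    ≡⟨ cong (λ z → (2 ^ ℓ + ⟦ z ⟧ * b) + (2 ^ ℓ + ⟦ ℓ ≡ᵇ d ⟧ * b)) (<⇒≡ᵇ-false (s≤s ℓ≤d)) ⟩
  (2 ^ ℓ + 0) + (2 ^ ℓ + ⟦ ℓ ≡ᵇ d ⟧ * b)
    ≡⟨ e (2 ^ ℓ) (⟦ ℓ ≡ᵇ d ⟧ * b) ⟩
  2 ^ suc ℓ + ⟦ ℓ ≡ᵇ d ⟧ * b ∎
  where
  open ≤-Reasoning
  ℓ = length ys
  bonus : List _ → ℕ
  bonus t = if length t ≡ᵇ suc d then b else 1
  e : ∀ x y → (x + 0) + (x + y) ≡ 2 * x + y
  e = solve-∀

module _ (mem : I → V → Bool) (d : I → ℕ) where

  full : List V → I → Bool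
  full t i = length (filterᵇ (mem i) t) ≡ᵇ d i

  -- The weight `U i`, due when i is full, is split in two. `W i` is paid in advance for every i
  -- that is full in `xs`; the rest, `g i * r i`, goes into a local function worth `2 ^ g i` on the
  -- full set and 1 elsewhere, to which `finner` applies. The resulting exponent is shared evenly,
  -- `m i` to each member of i. An index not full in `xs` has local sum 2^ℓ, and `r i ≤ m i` is
  -- enough for it.
  level-step : (is : List I) (xs : List V) (R : ℕ) .{{_ : NonZero R}} (F : List V → ℕ)
    (U W g r m : I → ℕ) (s : V → ℕ) →
    (∀ {t} → t ∈ sublists xs → F t ^ R ≤ 2 ^ ∑ (filterᵇ (full t) is) U) →
    (∀ {i} → i ∈ is → length (filterᵇ (mem i) xs) ≤ d i) →
    (∀ {i} → i ∈ is → U i ≤ W i + g i * r i) →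
    (∀ {i} → i ∈ is → (2 ^ d i + 2 ^ g i) ^ r i * 2 ^ W i ≤ 2 ^ (d i * m i)) →
    (∀ {i} → i ∈ is → r i ≤ m i) →
    (∀ {x} → x ∈ xs → R ≤ s x + ∑ is (λ i → ⟦ mem i x ⟧ * r i)) →
    ∑ (sublists xs) F ^ R ≤ 2 ^ ∑ xs (λ x → s x + ∑ is (λ i → ⟦ mem i x ⟧ * m i))
  level-step is xs R F U W g r m s hyp deg U≤ loc r≤m cover = begin
    ∑ (sublists xs) F ^ R
      ≤⟨ finner mem is r s R xs cover C F G hyp′ ⟩
    C * (2 ^ ∑ xs s * ∏ is (λ i → L i ^ r i))
      ≡⟨ e C (2 ^ ∑ xs s) _ ⟩
    2 ^ ∑ xs s * (∏ is (λ i → L i ^ r i) * C)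
      ≡⟨ cong (2 ^ ∑ xs s *_) (sym (∏-* is _ _)) ⟩
    2 ^ ∑ xs s * ∏ is (λ i → L i ^ r i * 2 ^ (⟦ full xs i ⟧ * W i))
      ≤⟨ *-monoʳ-≤ (2 ^ ∑ xs s) (∏-mono is local) ⟩
    2 ^ ∑ xs s * ∏ is (λ i → 2 ^ (ℓ i * m i))
      ≡⟨ cong (2 ^ ∑ xs s *_) (∏-2^ is (λ i → ℓ i * m i)) ⟩
    2 ^ ∑ xs s * 2 ^ ∑ is (λ i → ℓ i * m i)
      ≡⟨ sym (^-distribˡ-+-* 2 (∑ xs s) _) ⟩
    2 ^ (∑ xs s + ∑ is (λ i → ℓ i * m i))
      -- Double counting of the pairs of an index and a point that it sees.
      ≡⟨ cong (λ z → 2 ^ (∑ xs s + z)) (trans (∑-cong is ℓm) (∑-swap is xs _)) ⟩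
    2 ^ (∑ xs s + ∑ xs (λ x → ∑ is (λ i → ⟦ mem i x ⟧ * m i)))
      ≡⟨ cong (2 ^_) (sym (∑-+ xs s _)) ⟩
    2 ^ ∑ xs (λ x → s x + ∑ is (λ i → ⟦ mem i x ⟧ * m i)) ∎
    where
    open ≤-Reasoning
    ℓ L : I → ℕ
    ℓ i = length (filterᵇ (mem i) xs)
    G : I → List V → ℕ
    G i t = if length t ≡ᵇ d i then 2 ^ g i else 1
    L i = ∑ (sublists (filterᵇ (mem i) xs)) (G i)
    C = ∏ is (λ i → 2 ^ (⟦ full xs i ⟧ * W i))
    e : ∀ a b c → a * (b * c) ≡ b * (c * a)
    e = solve-∀
    ℓm : ∀ i → ℓ i * m i ≡ ∑ xs (λ x → ⟦ mem i x ⟧ * m i)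
    ℓm i = trans (cong (_* m i) (length-filterᵇ (mem i) xs)) (trans (*-comm _ (m i))
      (trans (sym (∑-*ˡ (m i) xs _)) (∑-cong xs (λ x → *-comm (m i) ⟦ mem i x ⟧))))

    local : ∀ {i} → i ∈ is → L i ^ r i * 2 ^ (⟦ full xs i ⟧ * W i) ≤ 2 ^ (ℓ i * m i)
    local {i} i∈ with full xs i in eq | ∑-sublists-bonus (filterᵇ (mem i) xs) (d i) (2 ^ g i) (deg i∈)
    ... | true  | L≤ = begin
      L i ^ r i * 2 ^ (W i + 0)              ≤⟨ *-mono-≤ (^-monoˡ-≤ (r i) L≤) (≤-reflexive (cong (2 ^_) (+-identityʳ (W i)))) ⟩
      (2 ^ ℓ i + (2 ^ g i + 0)) ^ r i * 2 ^ W i  ≡⟨ cong₂ (λ y z → (2 ^ y + z) ^ r i * 2 ^ W i) ℓ≡d (+-identityʳ _) ⟩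
      (2 ^ d i + 2 ^ g i) ^ r i * 2 ^ W i    ≤⟨ loc i∈ ⟩
      2 ^ (d i * m i)                        ≡⟨ cong (λ z → 2 ^ (z * m i)) (sym ℓ≡d) ⟩
      2 ^ (ℓ i * m i)                        ∎
      where ℓ≡d = ≡ᵇ-true⇒≡ (ℓ i) (d i) eq
    ... | false | L≤ = begin
      L i ^ r i * 1            ≡⟨ *-identityʳ _ ⟩
      L i ^ r i                ≤⟨ ^-monoˡ-≤ (r i) L≤ ⟩
      (2 ^ ℓ i + 0) ^ r i      ≡⟨ cong (_^ r i) (+-identityʳ (2 ^ ℓ i)) ⟩
      (2 ^ ℓ i) ^ r i          ≡⟨ ^-*-assoc 2 (ℓ i) (r i) ⟩
      2 ^ (ℓ i * r i)          ≤⟨ ^-monoʳ-≤ 2 (*-monoʳ-≤ (ℓ i) (r≤m i∈)) ⟩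
      2 ^ (ℓ i * m i)          ∎

    1≤G^r : ∀ i t → 1 ≤ G i t ^ r i
    1≤G^r i t with length t ≡ᵇ d i
    ... | true  = m^n>0 (2 ^ g i) {{m^n≢0 2 (g i)}} (r i)
    ... | false = m^n>0 1 (r i)

    pointwise : ∀ {t} → t ∈ sublists xs → ∀ {i} → i ∈ is →
      2 ^ (⟦ full t i ⟧ * U i) ≤ 2 ^ (⟦ full xs i ⟧ * W i) * G i (filterᵇ (mem i) t) ^ r i
    pointwise {t} t∈ {i} i∈ = by-cases (full t i) refl
      where
      by-cases : ∀ b → full t i ≡ b →
        2 ^ (⟦ b ⟧ * U i) ≤ 2 ^ (⟦ full xs i ⟧ * W i) * G i (filterᵇ (mem i) t) ^ r i
      by-cases false _  = *-mono-≤ (m^n>0 2 (⟦ full xs i ⟧ * W i)) (1≤G^r i (filterᵇ (mem i) t))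
      by-cases true  eq = begin
        2 ^ (U i + 0)                         ≡⟨ cong (2 ^_) (+-identityʳ (U i)) ⟩
        2 ^ U i                               ≤⟨ ^-monoʳ-≤ 2 (U≤ i∈) ⟩
        2 ^ (W i + g i * r i)                 ≡⟨ ^-distribˡ-+-* 2 (W i) _ ⟩
        2 ^ W i * 2 ^ (g i * r i)             ≡⟨ cong₂ (λ y z → 2 ^ y * z) (sym (+-identityʳ (W i))) (sym (^-*-assoc 2 (g i) (r i))) ⟩
        2 ^ (⟦ true ⟧ * W i) * (if true then 2 ^ g i else 1) ^ r i
          ≡⟨ cong₂ (λ y z → 2 ^ (⟦ y ⟧ * W i) * (if z then 2 ^ g i else 1) ^ r i) (sym fullxs) (sym eq) ⟩
        2 ^ (⟦ full xs i ⟧ * W i) * G i (filterᵇ (mem i) t) ^ r i ∎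
        where
        -- An index full in a sublist is full in `xs`, so its `W i` has been paid.
        fullxs : full xs i ≡ true
        fullxs = trans (cong (_≡ᵇ d i) (≤-antisym (deg i∈)
          (subst (_≤ ℓ i) (≡ᵇ-true⇒≡ _ (d i) eq) (length-filterᵇ-sublists (mem i) xs t∈)))) (≡ᵇ-refl (d i))

    hyp′ : ∀ {t} → t ∈ sublists xs → F t ^ R ≤ C * ∏ is (λ i → G i (filterᵇ (mem i) t) ^ r i)
    hyp′ {t} t∈ = begin
      F t ^ R                                          ≤⟨ hyp t∈ ⟩
      2 ^ ∑ (filterᵇ (full t) is) U                    ≡⟨ cong (2 ^_) (∑-filterᵇ (full t) is U) ⟩
      2 ^ ∑ is (λ i → ⟦ full t i ⟧ * U i)              ≡⟨ sym (∏-2^ is _) ⟩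
      ∏ is (λ i → 2 ^ (⟦ full t i ⟧ * U i))            ≤⟨ ∏-mono is (pointwise t∈) ⟩
      ∏ is (λ i → 2 ^ (⟦ full xs i ⟧ * W i) * G i (filterᵇ (mem i) t) ^ r i)   ≡⟨ ∏-* is _ _ ⟩
      C * ∏ is (λ i → G i (filterᵇ (mem i) t) ^ r i)   ∎

-- Duplicate-free lists and their sublists.

length-injective : (f : A → B) {xs : List A} → Unique xs →
  (∀ {x y} → x ∈ xs → y ∈ xs → f x ≡ f y → x ≡ y) →
  {ys : List B} → (∀ {x} → x ∈ xs → f x ∈ ys) → length xs ≤ length ys
length-injective f {[]}     _            inj into = z≤n
length-injective f {x ∷ xs} (x∉ ∷ uniq) inj into with ∈-∃++ (into (here refl))
... | ls , rs , refl = subst (suc (length xs) ≤_) (sym len)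
  (s≤s (length-injective f uniq (λ x∈ y∈ → inj (there x∈) (there y∈)) into′))
  where
  len : length (ls ++ [ f x ] ++ rs) ≡ suc (length (ls ++ rs))
  len = trans (length-++ ls) (trans (+-suc (length ls) (length rs)) (cong suc (sym (length-++ ls))))
  into′ : ∀ {y} → y ∈ xs → f y ∈ ls ++ rs
  into′ y∈ with ∈-++⁻ ls (into (there y∈))
  ... | inj₁ ∈ls                 = ∈-++⁺ˡ ∈ls
  ... | inj₂ (there ∈rs)         = ∈-++⁺ʳ ls ∈rs
  ... | inj₂ (here fy≡fx)        = contradiction (inj (here refl) (there y∈) (sym fy≡fx)) (All.lookup x∉ y∈)

∈-sublists⇒⊆ : {xs t : List A} {y : A} → t ∈ sublists xs → y ∈ t → y ∈ xs
∈-sublists⇒⊆ {xs = []}     (here refl) ()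
∈-sublists⇒⊆ {xs = x ∷ xs} t∈ y∈ with ∈-++⁻ (sublists xs) t∈
... | inj₁ t∈xs = there (∈-sublists⇒⊆ t∈xs y∈)
... | inj₂ t∈x∷ with ∈-map⁻ (x ∷_) t∈x∷ | y∈
...   | t′ , t′∈ , refl | here y≡x  = here y≡x
...   | t′ , t′∈ , refl | there y∈′ = there (∈-sublists⇒⊆ t′∈ y∈′)

sublists-unique : {xs : List A} → Unique xs → Unique (sublists xs)
sublists-unique []           = [] ∷ []
sublists-unique {xs = x ∷ xs} (x∉ ∷ uniq) =
  Uniqueₚ.++⁺ (sublists-unique uniq) (Uniqueₚ.map⁺ (proj₂ ∘ ∷-injectiveˡʳ) (sublists-unique uniq)) disjoint
  where
  disjoint : ∀ {t} → ¬ (t ∈ sublists xs × t ∈ map (x ∷_) (sublists xs))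
  disjoint (t∈ , t∈′) with ∈-map⁻ (x ∷_) t∈′
  ... | _ , _ , refl = All.lookup x∉ (∈-sublists⇒⊆ t∈ (here refl)) refl

-- Sublists inherit the order of `xs`, so in the absence of duplicates the set of elements
-- determines the list. This makes the level-by-level record of an antichain injective on lists.
sublists-ext : {xs t u : List A} → Unique xs → t ∈ sublists xs → u ∈ sublists xs →
  (∀ {z} → z ∈ t → z ∈ u) → (∀ {z} → z ∈ u → z ∈ t) → t ≡ u
sublists-ext {xs = []}     _ (here refl) (here refl) _ _ = refl
sublists-ext {xs = x ∷ xs} (x∉ ∷ uniq) t∈ u∈ t⊆u u⊆t with ∈-++⁻ (sublists xs) t∈ | ∈-++⁻ (sublists xs) u∈
... | inj₁ t∈ | inj₁ u∈ = sublists-ext uniq t∈ u∈ t⊆u u⊆t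
... | inj₁ t∈ | inj₂ u∈ with ∈-map⁻ (x ∷_) u∈
...   | u′ , u′∈ , refl = contradiction refl (All.lookup x∉ (∈-sublists⇒⊆ t∈ (u⊆t (here refl))))
sublists-ext {xs = x ∷ xs} (x∉ ∷ uniq) _ _ t⊆u u⊆t | inj₂ t∈ | inj₁ u∈ with ∈-map⁻ (x ∷_) t∈
...   | t′ , t′∈ , refl = contradiction refl (All.lookup x∉ (∈-sublists⇒⊆ u∈ (t⊆u (here refl))))
sublists-ext {xs = x ∷ xs} (x∉ ∷ uniq) _ _ t⊆u u⊆t | inj₂ t∈ | inj₂ u∈ with ∈-map⁻ (x ∷_) t∈ | ∈-map⁻ (x ∷_) u∈
...   | t′ , t′∈ , refl | u′ , u′∈ , refl =
  cong (x ∷_) (sublists-ext uniq t′∈ u′∈ (λ z∈ → strip t′∈ z∈ (t⊆u (there z∈))) (λ z∈ → strip u′∈ z∈ (u⊆t (there z∈))))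
  where
  strip : ∀ {t v z} → t ∈ sublists xs → z ∈ t → z ∈ x ∷ v → z ∈ v
  strip t∈ z∈t (here refl) = contradiction refl (All.lookup x∉ (∈-sublists⇒⊆ t∈ z∈t))
  strip t∈ z∈t (there z∈v) = z∈v

filter∈sublists : {P : A → Set} (P? : Decidable P) (q : A → Bool) (xs : List A) →
  (∀ {x} → x ∈ xs → P x → q x ≡ true) → filter P? xs ∈ sublists (filterᵇ q xs)
filter∈sublists P? q []       imp = here refl
filter∈sublists P? q (x ∷ xs) imp with P? x | q x in eq
... | yes px | true  = ∈-++⁺ʳ (sublists (filterᵇ q xs)) (∈-map⁺ (x ∷_) (filter∈sublists P? q xs (imp ∘ there)))
... | yes px | false with trans (sym eq) (imp (here refl) px)
...   | ()
filter∈sublists P? q (x ∷ xs) imp | no _ | true  = ∈-++⁺ˡ (filter∈sublists P? q xs (imp ∘ there))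
filter∈sublists P? q (x ∷ xs) imp | no _ | false = filter∈sublists P? q xs (imp ∘ there)

∑-filter : {P : A → Set} (P? : Decidable P) (xs : List A) (f : A → ℕ) →
  ∑ (filter P? xs) f ≡ ∑ xs (λ x → ⟦ does (P? x) ⟧ * f x)
∑-filter P? []       f = refl
∑-filter P? (x ∷ xs) f with does (P? x)
... | true  = cong₂ _+_ (sym (+-identityʳ (f x))) (∑-filter P? xs f)
... | false = ∑-filter P? xs f

∑-filter-support : {P : A → Set} (P? : Decidable P) (xs : List A) (q : A → Bool) →
  (∀ {x} → x ∈ xs → q x ≡ true → P x) → ∑ (filter P? xs) (λ x → ⟦ q x ⟧) ≡ ∑ xs (λ x → ⟦ q x ⟧)
∑-filter-support P? []       q imp = refl
∑-filter-support P? (x ∷ xs) q imp with P? x | q x in eq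
... | yes _  | true  = cong₂ _+_ (cong ⟦_⟧ eq) (∑-filter-support P? xs q (imp ∘ there))
... | yes _  | false = cong₂ _+_ (cong ⟦_⟧ eq) (∑-filter-support P? xs q (imp ∘ there))
... | no ¬px | true  = contradiction (imp (here refl) eq) ¬px
... | no _   | false = ∑-filter-support P? xs q (imp ∘ there)

-- Degrees, covers and enumeration of the points.

-- The number of nonzero coordinates is the down-degree, the number of coordinates other than 2 the up-degree.
down up : ∀ {n} → Point 3 n → ℕ
down []       = 0
down (0F ∷ x) = down x
down (1F ∷ x) = suc (down x)
down (2F ∷ x) = suc (down x)
up []       = 0
up (0F ∷ x) = suc (up x)
up (1F ∷ x) = suc (up x)
up (2F ∷ x) = up x

-- A coordinate a adds a + [a < 2] on the left and 1 + [a > 0] on the right, and these agree for a =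
-- 0, 1, 2. Hence down-degree minus up-degree is the height above the middle level, the only source
-- of the degree comparisons between levels.
rank+up≡n+down : ∀ {n} (x : Point 3 n) → rank x + up x ≡ n + down x
rank+up≡n+down []                 = refl
rank+up≡n+down {suc n} (0F ∷ x) = trans (+-suc (rank x) (up x)) (cong suc (rank+up≡n+down x))
rank+up≡n+down {suc n} (1F ∷ x) = cong suc (trans (+-suc (rank x) (up x))
  (trans (cong suc (rank+up≡n+down x)) (sym (+-suc n (down x)))))
rank+up≡n+down {suc n} (2F ∷ x) = cong suc (trans (cong suc (rank+up≡n+down x)) (sym (+-suc n (down x))))

n≤up+down : ∀ {n} (x : Point 3 n) → n ≤ up x + down x
n≤up+down []       = z≤n
n≤up+down (0F ∷ x) = s≤s (n≤up+down x)
n≤up+down (1F ∷ x) = s≤s (≤-trans (n≤up+down x) (+-monoʳ-≤ (up x) (n≤1+n _)))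
n≤up+down (2F ∷ x) = ≤-trans (s≤s (n≤up+down x)) (≤-reflexive (sym (+-suc (up x) (down x))))

down≤n : ∀ {n} (x : Point 3 n) → down x ≤ n
down≤n []       = z≤n
down≤n (0F ∷ x) = m≤n⇒m≤1+n (down≤n x)
down≤n (1F ∷ x) = s≤s (down≤n x)
down≤n (2F ∷ x) = s≤s (down≤n x)

up≤n : ∀ {n} (x : Point 3 n) → up x ≤ n
up≤n []       = z≤n
up≤n (0F ∷ x) = s≤s (up≤n x)
up≤n (1F ∷ x) = s≤s (up≤n x)
up≤n (2F ∷ x) = m≤n⇒m≤1+n (up≤n x)

down≤rank : ∀ {n} (x : Point 3 n) → down x ≤ rank x
down≤rank []       = z≤n
down≤rank (0F ∷ x) = down≤rank x
down≤rank (1F ∷ x) = s≤s (down≤rank x)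
down≤rank (2F ∷ x) = s≤s (m≤n⇒m≤1+n (down≤rank x))

rank≤2*down : ∀ {n} (x : Point 3 n) → rank x ≤ 2 * down x
rank≤2*down []       = z≤n
rank≤2*down (0F ∷ x) = rank≤2*down x
rank≤2*down (1F ∷ x) = ≤-trans (s≤s (m≤n⇒m≤1+n (rank≤2*down x))) (≤-reflexive (sym (*-suc 2 (down x))))
rank≤2*down (2F ∷ x) = ≤-trans (s≤s (s≤s (rank≤2*down x))) (≤-reflexive (sym (*-suc 2 (down x))))

rank≤2n : ∀ {n} (x : Point 3 n) → rank x ≤ 2 * n
rank≤2n x = ≤-trans (rank≤2*down x) (*-monoʳ-≤ 2 (down≤n x))

_≟ₚ_ : ∀ {n} (x y : Point 3 n) → Dec (x ≡ y)
_≟ₚ_ = ≡-dec Finₚ._≟_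

infix 4 _⋖_
_⋖_ : ∀ {n} → Point 3 n → Point 3 n → Bool
[]       ⋖ []       = false
(0F ∷ x) ⋖ (0F ∷ y) = x ⋖ y
(0F ∷ x) ⋖ (1F ∷ y) = does (x ≟ₚ y)
(0F ∷ x) ⋖ (2F ∷ y) = false
(1F ∷ x) ⋖ (0F ∷ y) = false
(1F ∷ x) ⋖ (1F ∷ y) = x ⋖ y
(1F ∷ x) ⋖ (2F ∷ y) = does (x ≟ₚ y)
(2F ∷ x) ⋖ (0F ∷ y) = false
(2F ∷ x) ⋖ (1F ∷ y) = false
(2F ∷ x) ⋖ (2F ∷ y) = x ⋖ y

-- The two kinds of cover, told apart by the degree that changes. The exponents in both halves of
-- the argument depend on a point only through its up-degree, so these changes decide how they
-- compare along a cover.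
data Step {n} (x y : Point 3 n) : Set where
  0↦1 : down y ≡ suc (down x) → up y ≡ up x → x ≼ y → Step x y
  1↦2 : down y ≡ down x → suc (up y) ≡ up x → x ≼ y → Step x y

≼-refl : ∀ {t n} {x : Point t n} → x ≼ x
≼-refl = PW.refl ≤-refl

≼-trans : ∀ {t n} {x y z : Point t n} → x ≼ y → y ≼ z → x ≼ z
≼-trans = PW.trans ≤-trans

≼-antisym : ∀ {t n} {x y : Point t n} → x ≼ y → y ≼ x → x ≡ y
≼-antisym []       []       = refl
≼-antisym (p ∷ ps) (q ∷ qs) = cong₂ _∷_ (Finₚ.toℕ-injective (≤-antisym p q)) (≼-antisym ps qs)

⋖⇒Step : ∀ {n} (x y : Point 3 n) → (x ⋖ y) ≡ true → Step x y
⋖⇒Step []       []       ()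
⋖⇒Step (0F ∷ x) (0F ∷ y) eq with ⋖⇒Step x y eq
... | 0↦1 d u le = 0↦1 d (cong suc u) (z≤n ∷ le)
... | 1↦2 d u le = 1↦2 d (cong suc u) (z≤n ∷ le)
⋖⇒Step (0F ∷ x) (1F ∷ y) eq with x ≟ₚ y
... | yes refl = 0↦1 refl refl (z≤n ∷ ≼-refl)
⋖⇒Step (0F ∷ x) (2F ∷ y) ()
⋖⇒Step (1F ∷ x) (1F ∷ y) eq with ⋖⇒Step x y eq
... | 0↦1 d u le = 0↦1 (cong suc d) (cong suc u) (s≤s z≤n ∷ le)
... | 1↦2 d u le = 1↦2 (cong suc d) (cong suc u) (s≤s z≤n ∷ le)
⋖⇒Step (1F ∷ x) (2F ∷ y) eq with x ≟ₚ y
... | yes refl = 1↦2 refl refl (s≤s z≤n ∷ ≼-refl)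
⋖⇒Step (2F ∷ x) (2F ∷ y) eq with ⋖⇒Step x y eq
... | 0↦1 d u le = 0↦1 (cong suc d) u (s≤s (s≤s z≤n) ∷ le)
... | 1↦2 d u le = 1↦2 (cong suc d) u (s≤s (s≤s z≤n) ∷ le)

⋖⇒≼ : ∀ {n} (x y : Point 3 n) → (x ⋖ y) ≡ true → x ≼ y
⋖⇒≼ x y eq with ⋖⇒Step x y eq
... | 0↦1 _ _ le = le
... | 1↦2 _ _ le = le

⋖⇒rank : ∀ {n} (x y : Point 3 n) → (x ⋖ y) ≡ true → rank y ≡ suc (rank x)
⋖⇒rank {n} x y eq with ⋖⇒Step x y eq
... | 0↦1 d u _ = +-cancelʳ-≡ (up x) _ _ (trans (cong (rank y +_) (sym u)) (trans (rank+up≡n+down y)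
  (trans (cong (n +_) d) (trans (+-suc n (down x)) (cong suc (sym (rank+up≡n+down x)))))))
... | 1↦2 d u _ = +-cancelʳ-≡ (up y) _ _ (trans (rank+up≡n+down y) (trans (cong (n +_) d)
  (trans (sym (rank+up≡n+down x)) (trans (cong (rank x +_) (sym u)) (+-suc (rank x) (up y))))))

∑-allPoints : ∀ n (f : Point 3 (suc n) → ℕ) → ∑ (allPoints 3 (suc n)) f ≡
  ∑ (allPoints 3 n) (f ∘ (0F ∷_)) + (∑ (allPoints 3 n) (f ∘ (1F ∷_)) + ∑ (allPoints 3 n) (f ∘ (2F ∷_)))
∑-allPoints n f = trans (∑-++ (map (0F ∷_) P) _ f) (cong₂ _+_ (∑-map _ P f)
  (trans (∑-++ (map (1F ∷_) P) _ f) (cong₂ _+_ (∑-map _ P f)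
    (trans (∑-++ (map (2F ∷_) P) [] f) (trans (+-identityʳ _) (∑-map _ P f))))))
  where P = allPoints 3 n

∑-≟ʳ : ∀ {n} (x : Point 3 n) → ∑ (allPoints 3 n) (λ y → ⟦ does (x ≟ₚ y) ⟧) ≡ 1
∑-≟ʳ []       = refl
∑-≟ʳ {suc n} (0F ∷ x) = trans (∑-allPoints n _)
  (cong₂ _+_ (∑-≟ʳ x) (cong₂ _+_ (∑-zero (allPoints 3 n)) (∑-zero (allPoints 3 n))))
∑-≟ʳ {suc n} (1F ∷ x) = trans (∑-allPoints n _)
  (cong₂ _+_ (∑-zero (allPoints 3 n)) (cong₂ _+_ (∑-≟ʳ x) (∑-zero (allPoints 3 n))))
∑-≟ʳ {suc n} (2F ∷ x) = trans (∑-allPoints n _)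
  (cong₂ _+_ (∑-zero (allPoints 3 n)) (cong₂ _+_ (∑-zero (allPoints 3 n)) (∑-≟ʳ x)))

∑-≟ˡ : ∀ {n} (y : Point 3 n) → ∑ (allPoints 3 n) (λ x → ⟦ does (x ≟ₚ y) ⟧) ≡ 1
∑-≟ˡ []       = refl
∑-≟ˡ {suc n} (0F ∷ y) = trans (∑-allPoints n _)
  (cong₂ _+_ (∑-≟ˡ y) (cong₂ _+_ (∑-zero (allPoints 3 n)) (∑-zero (allPoints 3 n))))
∑-≟ˡ {suc n} (1F ∷ y) = trans (∑-allPoints n _)
  (cong₂ _+_ (∑-zero (allPoints 3 n)) (cong₂ _+_ (∑-≟ˡ y) (∑-zero (allPoints 3 n))))
∑-≟ˡ {suc n} (2F ∷ y) = trans (∑-allPoints n _)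
  (cong₂ _+_ (∑-zero (allPoints 3 n)) (cong₂ _+_ (∑-zero (allPoints 3 n)) (∑-≟ˡ y)))

∑-⋖ʳ : ∀ {n} (x : Point 3 n) → ∑ (allPoints 3 n) (λ y → ⟦ x ⋖ y ⟧) ≡ up x
∑-⋖ʳ []       = refl
∑-⋖ʳ {suc n} (0F ∷ x) = trans (∑-allPoints n _)
  (trans (cong₂ _+_ (∑-⋖ʳ x) (cong₂ _+_ (∑-≟ʳ x) (∑-zero (allPoints 3 n)))) (+-comm (up x) 1))
∑-⋖ʳ {suc n} (1F ∷ x) = trans (∑-allPoints n _)
  (trans (cong₂ _+_ (∑-zero (allPoints 3 n)) (cong₂ _+_ (∑-⋖ʳ x) (∑-≟ʳ x))) (+-comm (up x) 1))
∑-⋖ʳ {suc n} (2F ∷ x) = trans (∑-allPoints n _)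
  (cong₂ _+_ (∑-zero (allPoints 3 n)) (cong₂ _+_ (∑-zero (allPoints 3 n)) (∑-⋖ʳ x)))

∑-⋖ˡ : ∀ {n} (y : Point 3 n) → ∑ (allPoints 3 n) (λ x → ⟦ x ⋖ y ⟧) ≡ down y
∑-⋖ˡ []       = refl
∑-⋖ˡ {suc n} (0F ∷ y) = trans (∑-allPoints n _)
  (trans (cong₂ _+_ (∑-⋖ˡ y) (cong₂ _+_ (∑-zero (allPoints 3 n)) (∑-zero (allPoints 3 n)))) (+-identityʳ (down y)))
∑-⋖ˡ {suc n} (1F ∷ y) = trans (∑-allPoints n _)
  (cong₂ _+_ (∑-≟ˡ y) (trans (cong₂ _+_ (∑-⋖ˡ y) (∑-zero (allPoints 3 n))) (+-identityʳ (down y))))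
∑-⋖ˡ {suc n} (2F ∷ y) = trans (∑-allPoints n _)
  (cong₂ _+_ (∑-zero (allPoints 3 n)) (cong₂ _+_ (∑-≟ˡ y) (∑-⋖ˡ y)))

∈-allPoints : ∀ {t n} (x : Point t n) → x ∈ allPoints t n
∈-allPoints []      = here refl
∈-allPoints (a ∷ x) = ∈-concatMap⁺ _ (lose (∈-allFin a) (∈-map⁺ (a ∷_) (∈-allPoints x)))

allPoints-unique : ∀ n → Unique (allPoints 3 n)
allPoints-unique zero    = [] ∷ []
allPoints-unique (suc n) = Uniqueₚ.cartesianProductWith⁺ {xs = allFin 3} _∷_
  (λ eq → ∷-injectiveˡ eq , ∷-injectiveʳ eq) (Uniqueₚ.allFin⁺ 3) (allPoints-unique n)

-- Auxiliary counts and a numerical estimate.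

length-concatMap : (f : A → List B) (xs : List A) → length (concatMap f xs) ≡ ∑ xs (length ∘ f)
length-concatMap f []       = refl
length-concatMap f (x ∷ xs) = trans (length-++ (f x)) (cong (length (f x) +_) (length-concatMap f xs))

∑-filterᵇ-≤ : (p : A → Bool) (xs : List A) (f : A → ℕ) → ∑ (filterᵇ p xs) f ≤ ∑ xs f
∑-filterᵇ-≤ p []       f = z≤n
∑-filterᵇ-≤ p (x ∷ xs) f with p x
... | true  = +-monoʳ-≤ (f x) (∑-filterᵇ-≤ p xs f)
... | false = ≤-trans (∑-filterᵇ-≤ p xs f) (m≤n+m _ (f x))

-- Bernoulli's inequality in reciprocal form: (1 + 1/M)^k ≤ 1 / (1 - k/M). Each factor is absorbed
-- by (M + 1) l ≤ M (l + 1), which holds as l ≤ M.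
bernoulli : ∀ M k l → k + l ≡ M → suc M ^ k * l ≤ M ^ k * M
bernoulli M zero    l eq = *-monoʳ-≤ 1 (≤-reflexive eq)
bernoulli M (suc k) l eq = begin
  suc M * suc M ^ k * l        ≡⟨ e₁ (suc M) (suc M ^ k) l ⟩
  suc M ^ k * (l + M * l)      ≤⟨ *-monoʳ-≤ (suc M ^ k) (+-monoˡ-≤ (M * l) (subst (l ≤_) eq (m≤n+m l (suc k)))) ⟩
  suc M ^ k * (M + M * l)      ≡⟨ e₂ (suc M ^ k) M l ⟩
  M * (suc M ^ k * suc l)      ≤⟨ *-monoʳ-≤ M (bernoulli M k (suc l) (trans (+-suc k l) eq)) ⟩
  M * (M ^ k * M)              ≡⟨ sym (*-assoc M (M ^ k) M) ⟩
  M * M ^ k * M                ∎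
  where
  open ≤-Reasoning
  e₁ : ∀ a b c → a * b * c ≡ b * (a * c)
  e₁ = solve-∀
  e₂ : ∀ a b c → a * (b + b * c) ≡ b * (a * suc c)
  e₂ = solve-∀

-- (1 + 1/4h)^(2h) ≤ 2 with h = 2^i.
[2^d+2^[d+i+2]]^2^[i+1] : ∀ d i →
  (2 ^ d + 2 ^ (d + i + 2)) ^ (2 ^ suc i) ≤ 2 ^ ((d + i + 2) * 2 ^ suc i + 1)
[2^d+2^[d+i+2]]^2^[i+1] d i = *-cancelˡ-≤ (2 * h) {{m^n≢0 2 (suc i)}} (begin
  2 * h * (2 ^ d + 2 ^ (d + i + 2)) ^ (2 * h)         ≡⟨ cong (λ z → 2 * h * z ^ (2 * h)) base ⟩
  2 * h * (2 ^ d * suc (4 * h)) ^ (2 * h)             ≡⟨ cong (2 * h *_) (^-distribʳ-* (2 ^ d) _ (2 * h)) ⟩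
  2 * h * ((2 ^ d) ^ (2 * h) * suc (4 * h) ^ (2 * h)) ≡⟨ e₁ (2 * h) ((2 ^ d) ^ (2 * h)) _ ⟩
  (2 ^ d) ^ (2 * h) * (suc (4 * h) ^ (2 * h) * (2 * h))
    -- With M = 4h and k = l = 2h the quotient M / l is the factor 2.
    ≤⟨ *-monoʳ-≤ ((2 ^ d) ^ (2 * h)) (bernoulli (4 * h) (2 * h) (2 * h) (e₂ h)) ⟩
  (2 ^ d) ^ (2 * h) * ((4 * h) ^ (2 * h) * (4 * h))   ≡⟨ e₃ h ((2 ^ d) ^ (2 * h)) _ ⟩
  2 * h * ((2 ^ d) ^ (2 * h) * (4 * h) ^ (2 * h) * 2) ≡⟨ cong (λ z → 2 * h * (z * 2)) (sym (^-distribʳ-* (2 ^ d) (4 * h) (2 * h))) ⟩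
  2 * h * ((2 ^ d * (4 * h)) ^ (2 * h) * 2)           ≡⟨ cong (λ z → 2 * h * (z ^ (2 * h) * 2)) (sym power) ⟩
  2 * h * ((2 ^ (d + i + 2)) ^ (2 * h) * 2)           ≡⟨ cong (λ z → 2 * h * (z * 2)) (^-*-assoc 2 (d + i + 2) (2 * h)) ⟩
  2 * h * (2 ^ ((d + i + 2) * (2 * h)) * 2)           ≡⟨ cong (2 * h *_) (sym (^-distribˡ-+-* 2 ((d + i + 2) * (2 * h)) 1)) ⟩
  2 * h * 2 ^ ((d + i + 2) * (2 * h) + 1)             ∎)
  where
  open ≤-Reasoning
  h = 2 ^ i
  e₁ : ∀ a b c → a * (b * c) ≡ b * (c * a)
  e₁ = solve-∀
  e₂ : ∀ h → 2 * h + 2 * h ≡ 4 * h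
  e₂ = solve-∀
  e₃ : ∀ h b c → b * (c * (4 * h)) ≡ 2 * h * (b * c * 2)
  e₃ = solve-∀
  e₄ : ∀ a b → a * b * 4 ≡ a * (4 * b)
  e₄ = solve-∀
  e₅ : ∀ a b → a + a * (4 * b) ≡ a * suc (4 * b)
  e₅ = solve-∀
  power : 2 ^ (d + i + 2) ≡ 2 ^ d * (4 * h)
  power = trans (^-distribˡ-+-* 2 (d + i) 2) (trans (cong (_* 4) (^-distribˡ-+-* 2 d i)) (e₄ (2 ^ d) h))
  base : 2 ^ d + 2 ^ (d + i + 2) ≡ 2 ^ d * suc (4 * h)
  base = trans (cong (2 ^ d +_) power) (e₅ (2 ^ d) h)

-- Antichains as down-sets chosen level by level.

module _ {n : ℕ} where

  level : ℕ → List (Point 3 n)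
  level k = filter (λ x → rank x ≟ k) (allPoints 3 n)

  ∈-level⇒rank : ∀ {k} {x} → x ∈ level k → rank x ≡ k
  ∈-level⇒rank {k} x∈ = proj₂ (∈-filter⁻ (λ x → rank x ≟ k) {xs = allPoints 3 n} x∈)

  ∈-level : ∀ x → x ∈ level (rank x)
  ∈-level x = ∈-filter⁺ (λ y → rank y ≟ rank x) (∈-allPoints x) refl

  up-degree : ∀ {k} {x} → x ∈ level k → ∑ (level (suc k)) (λ y → ⟦ x ⋖ y ⟧) ≡ up x
  up-degree {k} {x} x∈ = trans (∑-filter-support (λ y → rank y ≟ suc k) (allPoints 3 n) (x ⋖_)
    (λ {y} _ eq → trans (⋖⇒rank x y eq) (cong suc (∈-level⇒rank x∈)))) (∑-⋖ʳ x)

  down-degree : ∀ {k} {y} → y ∈ level (suc k) → ∑ (level k) (λ x → ⟦ x ⋖ y ⟧) ≡ down y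
  down-degree {k} {y} y∈ = trans (∑-filter-support (λ x → rank x ≟ k) (allPoints 3 n) (_⋖ y)
    (λ {x} _ eq → suc-injective (trans (sym (⋖⇒rank x y eq)) (∈-level⇒rank y∈)))) (∑-⋖ˡ y)

  allowed : List (Point 3 n) → Point 3 n → Bool
  allowed = full (λ y x → x ⋖ y) down

  -- A down-set is recorded level by level: on level k + 1 only elements all of whose lower covers
  -- belong to the part s on level k may be chosen.
  extensions : ℕ → ℕ → List (Point 3 n) → ℕ
  extensions zero    k s = 1
  extensions (suc j) k s = ∑ (sublists (filterᵇ (allowed s) (level k))) (extensions j (suc k))

  -- The choices that `extensions` counts, listed explicitly to serve as the target of an injection.
  towers : ℕ → ℕ → List (Point 3 n) → List (List (List (Point 3 n)))
  towers zero    k s = [ [] ]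
  towers (suc j) k s = concatMap (λ t → map (t ∷_) (towers j (suc k) t)) (sublists (filterᵇ (allowed s) (level k)))

  length-towers : ∀ j k s → length (towers j k s) ≡ extensions j k s
  length-towers zero    k s = refl
  length-towers (suc j) k s = trans (length-concatMap _ (sublists (filterᵇ (allowed s) (level k))))
    (∑-cong (sublists (filterᵇ (allowed s) (level k)))
      (λ t → trans (length-map (t List.∷_) (towers j (suc k) t)) (length-towers j (suc k) t)))

  Free : List (Point 3 n) → Point 3 n → Set
  Free a x = ¬ Any (_≼ x) a

  free? : ∀ a → Decidable (Free a)
  free? a x = ¬? (any? (_≼? x) a)

  tower : List (Point 3 n) → ℕ → ℕ → List (List (Point 3 n))
  tower a zero    k = []
  tower a (suc j) k = filter (free? a) (level k) ∷ tower a j (suc k)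

  -- Free points form a down-set: an element of `a` below a lower cover of y is below y. So all
  -- lower covers of a free y survive the filter, and their number is `down y`.
  tower∈towers : ∀ a j k s → (∀ {x} → x ∈ level k → Free a x → allowed s x ≡ true) → tower a j k ∈ towers j k s
  tower∈towers a zero    k s ok = here refl
  tower∈towers a (suc j) k s ok = ∈-concatMap⁺ _ (lose
    (filter∈sublists (free? a) (allowed s) (level k) ok)
    (∈-map⁺ _ (tower∈towers a j (suc k) t ok′)))
    where
    t = filter (free? a) (level k)
    ok′ : ∀ {y} → y ∈ level (suc k) → Free a y → allowed t y ≡ true
    ok′ {y} y∈ free = trans (cong (_≡ᵇ down y) (trans (length-filterᵇ (_⋖ y) t)
      (trans (∑-filter-support (free? a) (level k) (_⋖ y)
        (λ {x} _ eq below → free (Any.map (λ le → ≼-trans le (⋖⇒≼ x y eq)) below)))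
      (down-degree y∈)))) (≡ᵇ-refl (down y))

  tower-level : ∀ a b j k → tower a j k ≡ tower b j k → ∀ i → k ≤ i → i < k + j →
    filter (free? a) (level i) ≡ filter (free? b) (level i)
  tower-level a b zero    k eq i k≤i i<k+0 = contradiction (subst (i <_) (+-identityʳ k) i<k+0) (≤⇒≯ k≤i)
  tower-level a b (suc j) k eq i k≤i i<k+j with k ≟ i
  ... | yes refl = proj₁ (∷-injectiveˡʳ eq)
  ... | no k≢i   = tower-level a b j (suc k) (proj₂ (∷-injectiveˡʳ eq)) i (≤∧≢⇒< k≤i k≢i) (subst (i <_) (+-suc k j) i<k+j)

  tower-free : ∀ a b → tower a (suc (2 * n)) 0 ≡ tower b (suc (2 * n)) 0 → ∀ {x} → Free a x → Free b x
  tower-free a b eq {x} free = proj₂ (∈-filter⁻ (free? b) {xs = level (rank x)}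
    (subst (x ∈_) (tower-level a b _ 0 eq (rank x) z≤n (s≤s (rank≤2n x))) (∈-filter⁺ (free? a) (∈-level x) free)))

  antichain-≼⇒≡ : ∀ {a x y} → IsAntichain {3} {n} a → x ∈ a → y ∈ a → x ≼ y → x ≡ y
  antichain-≼⇒≡ (_ ∷ _)  (here refl) (here refl) _  = refl
  antichain-≼⇒≡ (i ∷ _)  (here refl) (there y∈)  le = contradiction le (proj₁ (All.lookup i y∈))
  antichain-≼⇒≡ (i ∷ _)  (there x∈)  (here refl) le = contradiction le (proj₂ (All.lookup i x∈))
  antichain-≼⇒≡ (_ ∷ is) (there x∈)  (there y∈)  le = antichain-≼⇒≡ is x∈ y∈ le

  -- An antichain is the set of minimal non-free points. Given x in `a`, some y in `b` is below x
  -- and some z in `a` is below y; then z = x in the antichain, hence y = x.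
  antichain-⊆ : ∀ {a b} → IsAntichain a → (∀ {x} → Free a x → Free b x) → (∀ {x} → Free b x → Free a x) →
    ∀ {x} → x ∈ a → x ∈ b
  antichain-⊆ {a} {b} anti a⇒b b⇒a {x} x∈a
    with find (below b b⇒a (lose x∈a ≼-refl))
    where
    below : ∀ {a x} b → (Free b x → Free a x) → Any (_≼ x) a → Any (_≼ x) b
    below {x = x} b imp any = decidable-stable (any? (_≼? x) b) (λ free → imp free any)
  ... | y , y∈b , y≼x with find (decidable-stable (any? (_≼? y) a) (λ free → a⇒b free (lose y∈b ≼-refl)))
  ...   | z , z∈a , z≼y with antichain-≼⇒≡ anti z∈a x∈a (≼-trans z≼y y≼x)
  ...     | refl = subst (_∈ b) (≼-antisym y≼x z≼y) y∈b

  α≤extensions : α 3 n ≤ extensions (suc (2 * n)) 0 []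
  α≤extensions = subst (α 3 n ≤_) (length-towers (suc (2 * n)) 0 [])
    (length-injective (λ a → tower a (suc (2 * n)) 0)
      (Uniqueₚ.filter⁺ (allPairs? incomparable?) (sublists-unique (allPoints-unique n)))
      inj
      -- A point of rank 0 has no lower cover, so the empty list allows all of level 0.
      (λ {a} _ → tower∈towers a (suc (2 * n)) 0 [] (λ {x} x∈ _ → cong (0 ≡ᵇ_)
        (n≤0⇒n≡0 (≤-trans (down≤rank x) (≤-reflexive (∈-level⇒rank x∈)))))))
    where
    inj : ∀ {a b} → a ∈ filter (allPairs? incomparable?) (sublists (allPoints 3 n)) →
          b ∈ filter (allPairs? incomparable?) (sublists (allPoints 3 n)) →
          tower a (suc (2 * n)) 0 ≡ tower b (suc (2 * n)) 0 → a ≡ b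
    inj {a} {b} a∈ b∈ eq with ∈-filter⁻ (allPairs? incomparable?) {xs = sublists (allPoints 3 n)} a∈
                            | ∈-filter⁻ (allPairs? incomparable?) {xs = sublists (allPoints 3 n)} b∈
    ... | a∈s , a-anti | b∈s , b-anti = sublists-ext (allPoints-unique n) a∈s b∈s
      (antichain-⊆ a-anti (tower-free a b eq) (tower-free b a (sym eq)))
      (antichain-⊆ b-anti (tower-free b a (sym eq)) (tower-free a b eq))

  length-level≤N : ∀ {k} → k ≤ 2 * n → length (level k) ≤ N 3 n
  length-level≤N {k} k≤ = ≤-max (levelSize 3 n) (∈-upTo⁺ (s≤s k≤))
    where
    ≤-max : ∀ (f : A → ℕ) {xs : List A} {x} → x ∈ xs → f x ≤ foldr _⊔_ 0 (map f xs)
    ≤-max f (here refl) = m≤m⊔n _ _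
    ≤-max f (there x∈)  = ≤-trans (≤-max f x∈) (m≤n⊔m _ _)

  -- Weighted bounds for the number of extensions.

  record Bound (j k R : ℕ) (U : Point 3 n → ℕ) : Set where
    constructor mkBound
    field
      -- The real weight of x is `U x / R`; R is a common denominator, moved to the left as a power.
      bound : ∀ s → extensions j k s ^ R ≤ 2 ^ ∑ (filterᵇ (allowed s) (level k)) U

  open Bound

  Bound-scale : ∀ {j k R U} c → Bound j k R U → Bound j k (R * c) (λ x → U x * c)
  Bound-scale {j} {k} {R} {U} c (mkBound bound) = mkBound λ s → let X = extensions j k s; xs = filterᵇ (allowed s) (level k) in begin
    X ^ (R * c)                            ≡⟨ sym (^-*-assoc X R c) ⟩
    (X ^ R) ^ c                            ≤⟨ ^-monoˡ-≤ c (bound s) ⟩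
    (2 ^ ∑ xs U) ^ c                       ≡⟨ ^-*-assoc 2 (∑ xs U) c ⟩
    2 ^ (∑ xs U * c)                       ≡⟨ cong (2 ^_) (trans (*-comm (∑ xs U) c) (sym (∑-*ˡ c xs U))) ⟩
    2 ^ ∑ xs (λ x → c * U x)               ≡⟨ cong (2 ^_) (∑-cong xs (λ x → *-comm c (U x))) ⟩
    2 ^ ∑ xs (λ x → U x * c)               ∎
    where open ≤-Reasoning

  Bound-mono : ∀ {j k R U U′} → (∀ {x} → x ∈ level k → U x ≤ U′ x) → Bound j k R U → Bound j k R U′
  Bound-mono {k = k} U≤ (mkBound bound) = mkBound λ s → ≤-trans (bound s) (^-monoʳ-≤ 2
    (∑-mono (filterᵇ (allowed s) (level k)) (λ x∈ → U≤ (proj₁ (∈-filter⁻ (T? ∘ allowed s) {xs = level k} x∈)))))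

  covers≤ : ∀ {k x} → x ∈ level k → (f : Point 3 n → ℕ) (c : ℕ) →
    (∀ {y} → y ∈ level (suc k) → (x ⋖ y) ≡ true → f y ≤ c) → ∑ (level (suc k)) (λ y → ⟦ x ⋖ y ⟧ * f y) ≤ up x * c
  covers≤ {k} {x} x∈ f c f≤ = begin
    ∑ (level (suc k)) (λ y → ⟦ x ⋖ y ⟧ * f y)  ≤⟨ ∑-mono (level (suc k)) (λ {y} y∈ → on (x ⋖ y) (f≤ y∈)) ⟩
    ∑ (level (suc k)) (λ y → c * ⟦ x ⋖ y ⟧)    ≡⟨ ∑-*ˡ c (level (suc k)) _ ⟩
    c * ∑ (level (suc k)) (λ y → ⟦ x ⋖ y ⟧)    ≡⟨ cong (c *_) (up-degree x∈) ⟩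
    c * up x                                   ≡⟨ *-comm c (up x) ⟩
    up x * c                                   ∎
    where
    open ≤-Reasoning
    on : ∀ b {m} → (b ≡ true → m ≤ c) → ⟦ b ⟧ * m ≤ c * ⟦ b ⟧
    on true  {m} le = subst₂ _≤_ (sym (*-identityˡ m)) (sym (*-identityʳ c)) (le refl)
    on false le = z≤n

  covers≥ : ∀ {k x} → x ∈ level k → (f : Point 3 n → ℕ) (c : ℕ) →
    (∀ {y} → y ∈ level (suc k) → (x ⋖ y) ≡ true → c ≤ f y) → up x * c ≤ ∑ (level (suc k)) (λ y → ⟦ x ⋖ y ⟧ * f y)
  covers≥ {k} {x} x∈ f c ≤f = begin
    up x * c                                   ≡⟨ *-comm (up x) c ⟩
    c * up x                                   ≡⟨ cong (c *_) (sym (up-degree x∈)) ⟩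
    c * ∑ (level (suc k)) (λ y → ⟦ x ⋖ y ⟧)    ≡⟨ sym (∑-*ˡ c (level (suc k)) _) ⟩
    ∑ (level (suc k)) (λ y → c * ⟦ x ⋖ y ⟧)    ≤⟨ ∑-mono (level (suc k)) (λ {y} y∈ → on (x ⋖ y) (≤f y∈)) ⟩
    ∑ (level (suc k)) (λ y → ⟦ x ⋖ y ⟧ * f y)  ∎
    where
    open ≤-Reasoning
    on : ∀ b {m} → (b ≡ true → c ≤ m) → c * ⟦ b ⟧ ≤ ⟦ b ⟧ * m
    on true  {m} le = subst₂ _≤_ (sym (*-identityʳ c)) (sym (*-identityˡ m)) (le refl)
    on false le = ≤-reflexive (*-zeroʳ c)

  Bound-step : ∀ {j k R} .{{_ : NonZero R}} {U : Point 3 n → ℕ} (W g r m s : Point 3 n → ℕ) → Bound j (suc k) R U →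
    (∀ {y} → y ∈ level (suc k) → U y ≤ W y + g y * r y) →
    (∀ {y} → y ∈ level (suc k) → (2 ^ down y + 2 ^ g y) ^ r y * 2 ^ W y ≤ 2 ^ (down y * m y)) →
    (∀ {y} → y ∈ level (suc k) → r y ≤ m y) →
    (∀ {x} → x ∈ level k → R ≤ s x + ∑ (level (suc k)) (λ y → ⟦ x ⋖ y ⟧ * r y)) →
    Bound (suc j) k R (λ x → s x + ∑ (level (suc k)) (λ y → ⟦ x ⋖ y ⟧ * m y))
  Bound-step {j} {k} {R} {U} W g r m s (mkBound bound) U≤ loc r≤m cover = mkBound λ t → let xs = filterᵇ (allowed t) (level k) in
    level-step (λ y x → x ⋖ y) down (level (suc k)) xs R (extensions j (suc k)) U W g r m s
      (λ {u} _ → bound u) (deg t) U≤ loc r≤m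
      (λ x∈ → cover (proj₁ (∈-filter⁻ (T? ∘ allowed t) {xs = level k} x∈)))
    where
    deg : ∀ t {y} → y ∈ level (suc k) → length (filterᵇ (_⋖ y) (filterᵇ (allowed t) (level k))) ≤ down y
    deg t {y} y∈ = subst₂ _≤_ (sym (length-filterᵇ (_⋖ y) (filterᵇ (allowed t) (level k)))) (down-degree y∈)
      (∑-filterᵇ-≤ (allowed t) (level k) (λ x → ⟦ x ⋖ y ⟧))

  -- A common multiple of all degrees; q m is E / m, except that q 0 = E.
  E : ℕ
  E = suc n !

  instance
    E≢0 : NonZero E
    E≢0 = suc n !≢0

  q : ℕ → ℕ
  q zero    = E
  q (suc m) = E / suc m

  m*q≡E : ∀ {m} → 1 ≤ m → m ≤ suc n → m * q m ≡ E
  m*q≡E {suc m} _ m≤ = trans (*-comm (suc m) (E / suc m)) (m/n*n≡m (∣-trans (m∣m*n (m !)) (m≤n⇒m!∣n! m≤)))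

  m*q≤E : ∀ m → m * q m ≤ E
  m*q≤E zero    = z≤n
  m*q≤E (suc m) = ≤-trans (≤-reflexive (*-comm (suc m) (E / suc m))) (m/n*n≤m E (suc m))

  -- With `q 0 = E` this includes l = 0, which spares a proof that the smaller degree is positive.
  q-anti : ∀ {l m} → l ≤ m → 1 ≤ m → m ≤ suc n → q m ≤ q l
  q-anti {zero}  {suc m} l≤m _ m≤ = ≤-trans (m≤m+n _ _) (m*q≤E (suc m))
  q-anti {suc l} {m} l≤m 1≤m m≤ = *-cancelˡ-≤ (suc l) (begin
    suc l * q m        ≤⟨ *-monoˡ-≤ (q m) l≤m ⟩
    m * q m            ≤⟨ m*q≤E m ⟩
    E                  ≡⟨ sym (m*q≡E (s≤s z≤n) (≤-trans l≤m m≤)) ⟩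
    suc l * q (suc l)  ∎)
    where open ≤-Reasoning

  -- Levels from the middle upwards.

  Upper : ℕ → Point 3 n → ℕ
  Upper κ x = E * E + κ * (E * q (down x))

  -- The exponent of the cover y is 1 / (1 + up y): since up x ≤ 1 + up y, the exponents of the covers of x
  -- add up to at most 1, and the one-point function at x makes up the difference s x.
  upper-step : ∀ {j k} κ → n ≤ k →
    (∀ {y} → y ∈ level (suc k) → 2 ^ down y + 2 ^ suc (suc (up y)) ≤ 2 ^ (down y + κ)) →
    Bound j (suc k) (E * E) (Upper 1) → Bound (suc j) k (E * E) (Upper κ)
  upper-step {j} {k} κ n≤k gap bound = Bound-mono U′≤
    (Bound-step {{m*n≢0 E E}} (λ _ → 0) (λ y → suc (suc (up y))) r m s bound U≤ loc (λ _ → m≤m+n _ _) (λ {x} _ → cover {x}))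
    where
    open ≤-Reasoning
    r m s : Point 3 n → ℕ
    r y = E * q (suc (up y))
    m y = r y + κ * (q (suc (up y)) * q (down y))
    s x = E * E ∸ ∑ (level (suc k)) (λ y → ⟦ x ⋖ y ⟧ * r y)

    up<down : ∀ {y} → y ∈ level (suc k) → suc (up y) ≤ down y
    up<down {y} y∈ = +-cancelˡ-≤ n _ _ (begin
      n + suc (up y)    ≡⟨ +-suc n (up y) ⟩
      suc (n + up y)    ≤⟨ s≤s (+-monoˡ-≤ (up y) n≤k) ⟩
      suc k + up y      ≡⟨ cong (_+ up y) (sym (∈-level⇒rank y∈)) ⟩
      rank y + up y     ≡⟨ rank+up≡n+down y ⟩
      n + down y        ∎)

    q*[1+up] : ∀ y → suc (up y) * q (suc (up y)) ≡ E
    q*[1+up] y = m*q≡E (s≤s z≤n) (s≤s (up≤n y))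

    1≤down : ∀ {y} → y ∈ level (suc k) → 1 ≤ down y
    1≤down y∈ = ≤-trans (s≤s z≤n) (up<down y∈)

    down≤1+n : ∀ (y : Point 3 n) → down y ≤ suc n
    down≤1+n y = m≤n⇒m≤1+n (down≤n y)

    -- This explains `g y = up y + 2` with nothing set aside: (up y + 2) / (up y + 1) = 1 + 1 / (up
    -- y + 1) is at least 1 + 1 / down y.
    U≤ : ∀ {y} → y ∈ level (suc k) → Upper 1 y ≤ suc (suc (up y)) * r y
    U≤ {y} y∈ = begin
      E * E + (E * q (down y) + 0)            ≡⟨ cong (E * E +_) (+-identityʳ _) ⟩
      E * E + E * q (down y)                  ≤⟨ +-monoʳ-≤ (E * E) (*-monoʳ-≤ E (q-anti (up<down y∈) (1≤down y∈) (down≤1+n y))) ⟩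
      E * E + E * q (suc (up y))              ≡⟨ cong (λ z → E * z + r y) (sym (q*[1+up] y)) ⟩
      E * (suc (up y) * q (suc (up y))) + r y ≡⟨ e E (up y) (q (suc (up y))) ⟩
      suc (suc (up y)) * r y                  ∎
      where
      e : ∀ E u q → E * (suc u * q) + E * q ≡ suc (suc u) * (E * q)
      e = solve-∀

    -- `m y` is `r y` times 1 + κ / down y: the κ extra bits are divided among the lower covers.
    loc : ∀ {y} → y ∈ level (suc k) → (2 ^ down y + 2 ^ suc (suc (up y))) ^ r y * 1 ≤ 2 ^ (down y * m y)
    loc {y} y∈ = begin
      (2 ^ down y + 2 ^ suc (suc (up y))) ^ r y * 1   ≡⟨ *-identityʳ _ ⟩
      (2 ^ down y + 2 ^ suc (suc (up y))) ^ r y       ≤⟨ ^-monoˡ-≤ (r y) (gap y∈) ⟩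
      (2 ^ (down y + κ)) ^ r y                        ≡⟨ ^-*-assoc 2 (down y + κ) (r y) ⟩
      2 ^ ((down y + κ) * r y)                        ≡⟨ cong (2 ^_) (*-distribʳ-+ (r y) (down y) κ) ⟩
      2 ^ (down y * r y + κ * (E * Q))                ≡⟨ cong (λ z → 2 ^ (down y * r y + κ * (z * Q))) (sym (m*q≡E (1≤down y∈) (down≤1+n y))) ⟩
      2 ^ (down y * r y + κ * (down y * q (down y) * Q)) ≡⟨ cong (2 ^_) (e (down y) (r y) κ (q (down y)) Q) ⟩
      2 ^ (down y * m y)                              ∎
      where
      Q = q (suc (up y))
      e : ∀ d r κ p Q → d * r + κ * (d * p * Q) ≡ d * (r + κ * (Q * p))
      e = solve-∀

    cover : ∀ {x} → E * E ≤ s x + ∑ (level (suc k)) (λ y → ⟦ x ⋖ y ⟧ * r y)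
    cover {x} = ≤-trans (m≤n+m∸n (E * E) S) (≤-reflexive (+-comm S (s x)))
      where S = ∑ (level (suc k)) (λ y → ⟦ x ⋖ y ⟧ * r y)

    q-up : ∀ x y → (x ⋖ y) ≡ true → q (suc (up y)) ≤ q (up x)
    q-up x y eq = q-anti up≤ (s≤s z≤n) (s≤s (up≤n y))
      where
      up≤ : up x ≤ suc (up y)
      up≤ with ⋖⇒Step x y eq
      ... | 0↦1 _ u _ = ≤-trans (≤-reflexive (sym u)) (n≤1+n _)
      ... | 1↦2 _ u _ = ≤-reflexive (sym u)

    q-down : ∀ x y → y ∈ level (suc k) → (x ⋖ y) ≡ true → q (down y) ≤ q (down x)
    q-down x y y∈ eq = q-anti down≤ (1≤down y∈) (down≤1+n y)
      where
      down≤ : down x ≤ down y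
      down≤ with ⋖⇒Step x y eq
      ... | 0↦1 d _ _ = ≤-trans (n≤1+n _) (≤-reflexive (sym d))
      ... | 1↦2 d _ _ = ≤-reflexive (sym d)

    S≤ : ∀ {x} → x ∈ level k → ∑ (level (suc k)) (λ y → ⟦ x ⋖ y ⟧ * r y) ≤ E * E
    S≤ {x} x∈ = begin
      ∑ (level (suc k)) (λ y → ⟦ x ⋖ y ⟧ * r y)  ≤⟨ covers≤ x∈ r (E * q (up x)) (λ {y} _ eq → *-monoʳ-≤ E (q-up x y eq)) ⟩
      up x * (E * q (up x))                      ≡⟨ e (up x) E (q (up x)) ⟩
      E * (up x * q (up x))                      ≤⟨ *-monoʳ-≤ E (m*q≤E (up x)) ⟩
      E * E                                      ∎
      where
      e : ∀ a b c → a * (b * c) ≡ b * (a * c)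
      e = solve-∀

    U′≤ : ∀ {x} → x ∈ level k → s x + ∑ (level (suc k)) (λ y → ⟦ x ⋖ y ⟧ * m y) ≤ Upper κ x
    U′≤ {x} x∈ = begin
      s x + ∑ (level (suc k)) (λ y → ⟦ x ⋖ y ⟧ * m y)
        ≡⟨ cong (s x +_) (trans (∑-cong (level (suc k)) (λ y → e₁ ⟦ x ⋖ y ⟧ (r y) κ _)) (trans (∑-+ (level (suc k)) _ _) (cong (S +_) (∑-*ˡ κ (level (suc k)) _)))) ⟩
      s x + (S + κ * ∑ (level (suc k)) (λ y → ⟦ x ⋖ y ⟧ * (q (suc (up y)) * q (down y))))
        ≡⟨ sym (+-assoc (s x) S _) ⟩
      s x + S + κ * ∑ (level (suc k)) (λ y → ⟦ x ⋖ y ⟧ * (q (suc (up y)) * q (down y)))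
        ≤⟨ +-mono-≤ (≤-reflexive (m∸n+n≡m (S≤ x∈))) (*-monoʳ-≤ κ (begin
             ∑ (level (suc k)) (λ y → ⟦ x ⋖ y ⟧ * (q (suc (up y)) * q (down y)))
               ≤⟨ covers≤ x∈ _ (q (up x) * q (down x)) (λ {y} y∈ eq → *-mono-≤ (q-up x y eq) (q-down x y y∈ eq)) ⟩
             up x * (q (up x) * q (down x))   ≡⟨ sym (*-assoc (up x) _ _) ⟩
             up x * q (up x) * q (down x)     ≤⟨ *-monoˡ-≤ (q (down x)) (m*q≤E (up x)) ⟩
             E * q (down x)                   ∎)) ⟩
      E * E + κ * (E * q (down x)) ∎
      where
      S = ∑ (level (suc k)) (λ y → ⟦ x ⋖ y ⟧ * r y)
      e₁ : ∀ b r κ z → b * (r + κ * z) ≡ b * r + κ * (b * z)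
      e₁ = solve-∀

  down-above : ∀ {k i} {y : Point 3 n} → y ∈ level (suc k) → n + i ≤ k → suc (i + up y) ≤ down y
  down-above {k} {i} {y} y∈ n+i≤k = +-cancelˡ-≤ n _ _ (begin
    n + suc (i + up y)   ≡⟨ e n i (up y) ⟩
    suc (n + i) + up y   ≤⟨ +-monoˡ-≤ (up y) (s≤s n+i≤k) ⟩
    suc k + up y         ≡⟨ cong (_+ up y) (sym (∈-level⇒rank y∈)) ⟩
    rank y + up y        ≡⟨ rank+up≡n+down y ⟩
    n + down y           ∎)
    where
    open ≤-Reasoning
    e : ∀ n i u → n + suc (i + u) ≡ suc (n + i) + u
    e = solve-∀

  2^-double : ∀ d → 2 ^ d + 2 ^ d ≡ 2 ^ (d + 1)
  2^-double d = trans (e (2 ^ d)) (sym (^-distribˡ-+-* 2 d 1))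
    where
    e : ∀ a → a + a ≡ a * 2
    e = solve-∀

  -- Levels k + 1 with k > n have `up y + 2 ≤ down y`, so the local sum is at most twice 2^(down y):
  -- one extra bit.
  above-middle : ∀ j k → n < k → Bound j k (E * E) (Upper 1)
  above-middle zero    k n<k = mkBound λ s → ≤-trans (≤-reflexive (^-zeroˡ (E * E))) (m^n>0 2 (∑ (filterᵇ (allowed s) (level k)) (Upper 1)))
  above-middle (suc j) k n<k = upper-step 1 (<⇒≤ n<k)
    (λ {y} y∈ → ≤-trans (+-monoʳ-≤ (2 ^ down y) (^-monoʳ-≤ 2 (down-above {i = 1} y∈ (≤-trans (≤-reflexive (+-comm n 1)) n<k))))
      (≤-reflexive (2^-double (down y))))
    (above-middle j (suc k) (m≤n⇒m≤1+n n<k))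

  -- On level n + 1 only `up y + 1 ≤ down y` is available, and the local sum can reach 3 · 2^(down
  -- y). Rounded up to 4 · 2^(down y), this costs two bits.
  at-middle : ∀ j → Bound (suc j) n (E * E) (Upper 2)
  at-middle j = upper-step 2 ≤-refl gap (above-middle j (suc n) ≤-refl)
    where
    open ≤-Reasoning
    gap : ∀ {y} → y ∈ level (suc n) → 2 ^ down y + 2 ^ suc (suc (up y)) ≤ 2 ^ (down y + 2)
    gap {y} y∈ = begin
      2 ^ down y + 2 ^ suc (suc (up y))   ≤⟨ +-monoʳ-≤ (2 ^ down y) (*-monoʳ-≤ 2 (^-monoʳ-≤ 2 (down-above {i = 0} y∈ (≤-reflexive (+-identityʳ n))))) ⟩
      2 ^ down y + 2 * 2 ^ down y         ≤⟨ m≤n+m _ (2 ^ down y) ⟩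
      2 ^ down y + (2 ^ down y + 2 * 2 ^ down y) ≡⟨ e (2 ^ down y) ⟩
      2 ^ down y * 4                      ≡⟨ sym (^-distribˡ-+-* 2 (down y) 2) ⟩
      2 ^ (down y + 2)                    ∎
      where
      e : ∀ a → a + (a + 2 * a) ≡ a * 4
      e = solve-∀

  -- Levels from the middle downwards.

  up≡down+ : ∀ {k i} {x : Point 3 n} → x ∈ level k → k + i ≡ n → up x ≡ down x + i
  up≡down+ {k} {i} {x} x∈ eq = +-cancelˡ-≡ k _ _ (begin-equality
    k + up x             ≡⟨ cong (_+ up x) (sym (∈-level⇒rank x∈)) ⟩
    rank x + up x        ≡⟨ rank+up≡n+down x ⟩
    n + down x           ≡⟨ cong (_+ down x) (sym eq) ⟩
    k + i + down x       ≡⟨ e k i (down x) ⟩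
    k + (down x + i)     ∎)
    where
    open ≤-Reasoning
    e : ∀ k i d → k + i + d ≡ k + (d + i)
    e = solve-∀

  n*q≤2*E : ∀ {m} → n ≤ m + m → n * q m ≤ 2 * E
  n*q≤2*E {m} n≤ = begin
    n * q m          ≤⟨ *-monoˡ-≤ (q m) n≤ ⟩
    (m + m) * q m    ≡⟨ e m (q m) ⟩
    2 * (m * q m)    ≤⟨ *-monoʳ-≤ 2 (m*q≤E m) ⟩
    2 * E            ∎
    where
    open ≤-Reasoning
    e : ∀ m q → (m + m) * q ≡ 2 * (m * q)
    e = solve-∀

  -- In units of R: every weight is at least 1 + 4/n, and the total is at most N (1 + 6/n - 2^(1-i)/n).
  record Lower (j k i : ℕ) : Set where
    field
      R     : ℕ
      U     : Point 3 n → ℕ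
      R≢0   : NonZero R
      upper : Bound j k R U
      large : ∀ {x} → x ∈ level k → R * (n + 4) ≤ n * U x
      total : 2 ^ i * (n * ∑ (level k) U) + 2 * (R * N 3 n) ≤ 2 ^ i * (R * N 3 n * (n + 6))

  -- On level n the two degrees agree and their sum is at least n, so 2 / down x ≤ 4/n. Every weight
  -- is raised to the constant 1 + 4/n, and at i = 0 the allowed total is 1 + 6/n - 2/n per point.
  lower-start : 1 ≤ n → Lower (suc n) n 0
  lower-start 1≤n = record
    { R     = E * E * n
    ; U     = λ _ → E * E * (n + 4)
    ; R≢0   = m*n≢0 (E * E) n {{m*n≢0 E E}} {{>-nonZero 1≤n}}
    ; upper = Bound-mono U≤ (Bound-scale n (at-middle n))
    ; large = λ _ → ≤-reflexive (e₁ (E * E) n)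
    ; total = begin
        1 * (n * ∑ (level n) (λ _ → E * E * (n + 4))) + 2 * (E * E * n * N 3 n)
          ≡⟨ cong (λ z → 1 * (n * z) + 2 * (E * E * n * N 3 n)) (∑-const (level n) _) ⟩
        1 * (n * (length (level n) * (E * E * (n + 4)))) + 2 * (E * E * n * N 3 n)
          ≤⟨ +-monoˡ-≤ (2 * (E * E * n * N 3 n)) (*-monoʳ-≤ 1 (*-monoʳ-≤ n (*-monoˡ-≤ (E * E * (n + 4)) (length-level≤N (m≤m+n n _))))) ⟩
        1 * (n * (N 3 n * (E * E * (n + 4)))) + 2 * (E * E * n * N 3 n)
          ≡⟨ e₂ n (N 3 n) (E * E) ⟩
        1 * (E * E * n * N 3 n * (n + 6)) ∎
    }
    where
    open ≤-Reasoning
    e₁ : ∀ a n → a * n * (n + 4) ≡ n * (a * (n + 4))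
    e₁ = solve-∀
    e₂ : ∀ n N a → 1 * (n * (N * (a * (n + 4)))) + 2 * (a * n * N) ≡ 1 * (a * n * N * (n + 6))
    e₂ = solve-∀
    e₃ : ∀ E q n → (E * E + 2 * (E * q)) * n ≡ E * E * n + 2 * (E * (n * q))
    e₃ = solve-∀
    e₄ : ∀ E n → E * E * n + 2 * (E * (2 * E)) ≡ E * E * (n + 4)
    e₄ = solve-∀
    U≤ : ∀ {x} → x ∈ level n → Upper 2 x * n ≤ E * E * (n + 4)
    U≤ {x} x∈ = begin
      (E * E + 2 * (E * q (down x))) * n        ≡⟨ e₃ E (q (down x)) n ⟩
      E * E * n + 2 * (E * (n * q (down x)))    ≤⟨ +-monoʳ-≤ (E * E * n) (*-monoʳ-≤ 2 (*-monoʳ-≤ E (n*q≤2*E {down x} n≤))) ⟩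
      E * E * n + 2 * (E * (2 * E))             ≡⟨ e₄ E n ⟩
      E * E * (n + 4)                           ∎
      where
      n≤ : n ≤ down x + down x
      n≤ = subst (λ z → n ≤ z + down x) (trans (up≡down+ x∈ (+-identityʳ n)) (+-identityʳ (down x))) (n≤up+down x)

  -- Here the exponent of y is 1 / up y, so the exponents of the covers of x add up to at least 1. The factor
  -- 2^(W y) is what remains of the weight of y after 2^(up y + 2), which is all that the local sum has to dominate.
  lower-step : ∀ {j k i} → k + suc i ≡ n → Lower j (suc k) i → Lower (suc j) k (suc i)
  lower-step {j} {k} {i} k+1+i≡n low = record
    { R     = R * (E * M)
    ; U     = U′
    ; R≢0   = R′≢0
    ; upper = Bound-step {{R′≢0}} W g r m (λ _ → 0) (Bound-scale (E * M) upper)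
                (λ {y} _ → m≤n+m∸n′ (U y * (E * M)) (g y * r y)) loc r≤m cover
    ; large = large′
    ; total = total′
    }
    where
    open Lower low
    open ≤-Reasoning
    H M : ℕ
    H = 2 ^ suc i
    -- H is the power to which the numerical estimate is raised. Including it in the denominator
    -- makes the loss 1 / (H · up y) integral.
    M = E * H
    g r m W U′ : Point 3 n → ℕ
    -- This is `up y + 2`, written so that 2^(g y) visibly exceeds 2^(down y) by the factor 4 · 2^i.
    g y = down y + i + 2
    r y = R * (q (up y) * M)
    -- In units of the new denominator: the old weight of y plus the loss 1 / (H · up y), divided by
    -- `down y`.
    m y = q (down y) * (U y * M + R * q (up y))
    W y = U y * (E * M) ∸ g y * r y
    U′ x = 0 + ∑ (level (suc k)) (λ y → ⟦ x ⋖ y ⟧ * m y)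

    m≤n+m∸n′ : ∀ a b → a ≤ (a ∸ b) + b
    m≤n+m∸n′ a b = ≤-trans (m≤n+m∸n a b) (≤-reflexive (+-comm b (a ∸ b)))

    instance
      M≢0 : NonZero M
      M≢0 = m*n≢0 E H {{it}} {{m^n≢0 2 (suc i)}}
    R′≢0 : NonZero (R * (E * M))
    R′≢0 = m*n≢0 R (E * M) {{R≢0}} {{m*n≢0 E M}}

    n≢0 : NonZero n
    n≢0 = >-nonZero (subst (0 <_) (trans (sym (+-suc k i)) k+1+i≡n) (s≤s z≤n))

    1+k+i≡n : suc k + i ≡ n
    1+k+i≡n = trans (sym (+-suc k i)) k+1+i≡n

    up-y : ∀ {y} → y ∈ level (suc k) → up y ≡ down y + i
    up-y y∈ = up≡down+ y∈ 1+k+i≡n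

    up-x : ∀ {x} → x ∈ level k → up x ≡ down x + suc i
    up-x x∈ = up≡down+ x∈ k+1+i≡n

    down≤up : ∀ {y} → y ∈ level (suc k) → down y ≤ up y
    down≤up {y} y∈ = subst (down y ≤_) (sym (up-y y∈)) (m≤m+n _ i)

    1≤down : ∀ {y} → y ∈ level (suc k) → 1 ≤ down y
    1≤down {y} y∈ = n≢0⇒n>0 (λ eq → n≮0 (subst₂ _≤_ (∈-level⇒rank y∈) (cong (2 *_) eq) (rank≤2*down y)))

    1≤up : ∀ {y} → y ∈ level (suc k) → 1 ≤ up y
    1≤up y∈ = ≤-trans (1≤down y∈) (down≤up y∈)

    down*q : ∀ {y} → y ∈ level (suc k) → down y * q (down y) ≡ E
    down*q {y} y∈ = m*q≡E (1≤down y∈) (m≤n⇒m≤1+n (down≤n y))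

    n*q-up : ∀ {y} → y ∈ level (suc k) → n * q (up y) ≤ 2 * E
    n*q-up {y} y∈ = n*q≤2*E {up y} (≤-trans (n≤up+down y) (+-monoʳ-≤ (up y) (down≤up y∈)))

    -- (up y + 2) / up y is at most 1 + 4/n because up y ≥ n/2, and `large` says that the weight is
    -- no smaller. So the truncated difference `W y` is a true one.
    g*r≤ : ∀ {y} → y ∈ level (suc k) → g y * r y ≤ U y * (E * M)
    g*r≤ {y} y∈ = *-cancelˡ-≤ n {{n≢0}} (begin
      n * ((down y + i + 2) * r y)            ≡⟨ cong (λ z → n * ((z + 2) * r y)) (sym (up-y y∈)) ⟩
      n * ((up y + 2) * (R * (q (up y) * M))) ≡⟨ e₁ n (up y) R (q (up y)) M ⟩
      R * M * (n * (up y * q (up y)) + 2 * (n * q (up y)))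
        ≤⟨ *-monoʳ-≤ (R * M) (+-mono-≤ (*-monoʳ-≤ n (m*q≤E (up y))) (*-monoʳ-≤ 2 (n*q-up y∈))) ⟩
      R * M * (n * E + 2 * (2 * E))           ≡⟨ e₂ R M n E ⟩
      R * (n + 4) * (E * M)                   ≤⟨ *-monoˡ-≤ (E * M) (large y∈) ⟩
      n * U y * (E * M)                       ≡⟨ *-assoc n (U y) (E * M) ⟩
      n * (U y * (E * M))                     ∎)
      where
      e₁ : ∀ n u R q M → n * ((u + 2) * (R * (q * M))) ≡ R * M * (n * (u * q) + 2 * (n * q))
      e₁ = solve-∀
      e₂ : ∀ R M n E → R * M * (n * E + 2 * (2 * E)) ≡ R * (n + 4) * (E * M)
      e₂ = solve-∀

    down*m : ∀ {y} → y ∈ level (suc k) → down y * m y ≡ U y * (E * M) + R * q (up y) * E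
    down*m {y} y∈ = begin-equality
      down y * (q (down y) * (U y * M + R * q (up y)))  ≡⟨ sym (*-assoc (down y) _ _) ⟩
      down y * q (down y) * (U y * M + R * q (up y))    ≡⟨ cong (_* (U y * M + R * q (up y))) (down*q y∈) ⟩
      E * (U y * M + R * q (up y))                      ≡⟨ e E (U y) M (R * q (up y)) ⟩
      U y * (E * M) + R * q (up y) * E                  ∎
      where
      e : ∀ E U M z → E * (U * M + z) ≡ U * (E * M) + z * E
      e = solve-∀

    loc : ∀ {y} → y ∈ level (suc k) → (2 ^ down y + 2 ^ g y) ^ r y * 2 ^ W y ≤ 2 ^ (down y * m y)
    loc {y} y∈ = begin
      (2 ^ down y + 2 ^ g y) ^ r y * 2 ^ W y           ≡⟨ cong (λ z → (2 ^ down y + 2 ^ g y) ^ z * 2 ^ W y) (e₁ R (q (up y)) E H) ⟩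
      (2 ^ down y + 2 ^ g y) ^ (H * ρ) * 2 ^ W y       ≡⟨ cong (_* 2 ^ W y) (sym (^-*-assoc _ H ρ)) ⟩
      ((2 ^ down y + 2 ^ g y) ^ H) ^ ρ * 2 ^ W y       ≤⟨ *-monoˡ-≤ (2 ^ W y) (^-monoˡ-≤ ρ ([2^d+2^[d+i+2]]^2^[i+1] (down y) i)) ⟩
      (2 ^ (g y * H + 1)) ^ ρ * 2 ^ W y                ≡⟨ cong (_* 2 ^ W y) (^-*-assoc 2 (g y * H + 1) ρ) ⟩
      2 ^ ((g y * H + 1) * ρ) * 2 ^ W y                ≡⟨ sym (^-distribˡ-+-* 2 ((g y * H + 1) * ρ) (W y)) ⟩
      2 ^ ((g y * H + 1) * ρ + W y)                    ≡⟨ cong (2 ^_) exponent ⟩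
      2 ^ (down y * m y)                               ∎
      where
      ρ = R * q (up y) * E
      e₁ : ∀ R q E H → R * (q * (E * H)) ≡ H * (R * q * E)
      e₁ = solve-∀
      e₂ : ∀ g H ρ w → (g * H + 1) * ρ + w ≡ w + g * (H * ρ) + ρ
      e₂ = solve-∀
      exponent : (g y * H + 1) * ρ + W y ≡ down y * m y
      exponent = begin-equality
        (g y * H + 1) * ρ + W y      ≡⟨ e₂ (g y) H ρ (W y) ⟩
        W y + g y * (H * ρ) + ρ      ≡⟨ cong (λ z → W y + g y * z + ρ) (sym (e₁ R (q (up y)) E H)) ⟩
        W y + g y * r y + ρ          ≡⟨ cong (_+ ρ) (m∸n+n≡m (g*r≤ y∈)) ⟩
        U y * (E * M) + ρ            ≡⟨ sym (down*m y∈) ⟩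
        down y * m y                 ∎

    R≤U : ∀ {y} → y ∈ level (suc k) → R ≤ U y
    R≤U {y} y∈ = *-cancelˡ-≤ n {{n≢0}} (begin
      n * R         ≡⟨ *-comm n R ⟩
      R * n         ≤⟨ *-monoʳ-≤ R (m≤m+n n 4) ⟩
      R * (n + 4)   ≤⟨ large y∈ ⟩
      n * U y       ∎)

    r≤m : ∀ {y} → y ∈ level (suc k) → r y ≤ m y
    r≤m {y} y∈ = begin
      R * (q (up y) * M)                            ≡⟨ e R (q (up y)) M ⟩
      q (up y) * (R * M)                            ≤⟨ *-mono-≤ (q-anti (down≤up y∈) (1≤up y∈) (m≤n⇒m≤1+n (up≤n y))) (*-monoˡ-≤ M (R≤U y∈)) ⟩
      q (down y) * (U y * M)                        ≤⟨ *-monoʳ-≤ (q (down y)) (m≤m+n (U y * M) _) ⟩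
      q (down y) * (U y * M + R * q (up y))         ∎
      where
      e : ∀ a b c → a * (b * c) ≡ b * (a * c)
      e = solve-∀

    1≤up-x : ∀ {x} → x ∈ level k → suc (down x) ≤ up x
    1≤up-x {x} x∈ = subst (suc (down x) ≤_) (sym (trans (up-x x∈) (+-suc (down x) i))) (s≤s (m≤m+n (down x) i))

    cover : ∀ {x} → x ∈ level k → R * (E * M) ≤ 0 + ∑ (level (suc k)) (λ y → ⟦ x ⋖ y ⟧ * r y)
    cover {x} x∈ = begin
      R * (E * M)                          ≡⟨ cong (λ z → R * (z * M)) (sym (m*q≡E 1≤ (m≤n⇒m≤1+n (up≤n x)))) ⟩
      R * (up x * q (up x) * M)            ≡⟨ e R (up x) (q (up x)) M ⟩
      up x * (R * (q (up x) * M))          ≤⟨ covers≥ x∈ r (R * (q (up x) * M)) (λ {y} _ eq → *-monoʳ-≤ R (*-monoˡ-≤ M (q-anti (up≤ y eq) 1≤ (m≤n⇒m≤1+n (up≤n x))))) ⟩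
      ∑ (level (suc k)) (λ y → ⟦ x ⋖ y ⟧ * r y) ∎
      where
      1≤ : 1 ≤ up x
      1≤ = ≤-trans (s≤s z≤n) (1≤up-x x∈)
      e : ∀ R u q M → R * (u * q * M) ≡ u * (R * (q * M))
      e = solve-∀
      up≤ : ∀ y → (x ⋖ y) ≡ true → up y ≤ up x
      up≤ y eq with ⋖⇒Step x y eq
      ... | 0↦1 _ u _ = ≤-reflexive u
      ... | 1↦2 _ u _ = ≤-trans (n≤1+n _) (≤-reflexive u)

    -- Each of the `up x` covers passes on at least (1 + 4/n) / (1 + down x), and up x ≥ 1 + down x
    -- below the middle.
    large′ : ∀ {x} → x ∈ level k → R * (E * M) * (n + 4) ≤ n * U′ x
    large′ {x} x∈ = begin
      R * (E * M) * (n + 4)                            ≡⟨ cong (λ z → R * (z * M) * (n + 4)) (sym (m*q≡E (s≤s z≤n) (s≤s (down≤n x)))) ⟩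
      R * (D * q D * M) * (n + 4)                      ≡⟨ e₁ R D (q D) M n ⟩
      D * (q D * (R * (n + 4) * M))                    ≤⟨ *-monoˡ-≤ (q D * (R * (n + 4) * M)) (1≤up-x x∈) ⟩
      up x * (q D * (R * (n + 4) * M))                 ≤⟨ covers≥ x∈ (λ y → n * m y) (q D * (R * (n + 4) * M)) (λ {y} → step y) ⟩
      ∑ (level (suc k)) (λ y → ⟦ x ⋖ y ⟧ * (n * m y))      ≡⟨ ∑-cong (level (suc k)) (λ y → e₂ ⟦ x ⋖ y ⟧ n (m y)) ⟩
      ∑ (level (suc k)) (λ y → n * (⟦ x ⋖ y ⟧ * m y))      ≡⟨ ∑-*ˡ n (level (suc k)) (λ y → ⟦ x ⋖ y ⟧ * m y) ⟩
      n * U′ x                                         ∎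
      where
      D = suc (down x)
      e₁ : ∀ R d q M n → R * (d * q * M) * (n + 4) ≡ d * (q * (R * (n + 4) * M))
      e₁ = solve-∀
      e₂ : ∀ a b c → a * (b * c) ≡ b * (a * c)
      e₂ = solve-∀
      e₃ : ∀ q n U M → q * (n * U * M) ≡ n * (q * (U * M))
      e₃ = solve-∀
      down≤ : ∀ y → (x ⋖ y) ≡ true → down y ≤ D
      down≤ y eq with ⋖⇒Step x y eq
      ... | 0↦1 d _ _ = ≤-reflexive d
      ... | 1↦2 d _ _ = ≤-trans (≤-reflexive d) (n≤1+n _)
      step : ∀ y → y ∈ level (suc k) → (x ⋖ y) ≡ true → q D * (R * (n + 4) * M) ≤ n * m y
      step y y∈ eq = begin
        q D * (R * (n + 4) * M)         ≤⟨ *-mono-≤ (q-anti (down≤ y eq) (s≤s z≤n) (s≤s (down≤n x))) (*-monoˡ-≤ M (large y∈)) ⟩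
        q (down y) * (n * U y * M)      ≡⟨ e₃ (q (down y)) n (U y) M ⟩
        n * (q (down y) * (U y * M))    ≤⟨ *-monoʳ-≤ n (*-monoʳ-≤ (q (down y)) (m≤m+n (U y * M) _)) ⟩
        n * m y                         ∎

    ∑U′ : ∑ (level k) U′ ≡ ∑ (level (suc k)) (λ y → ∑ (level k) (λ x → ⟦ x ⋖ y ⟧ * m y))
    ∑U′ = ∑-swap (level k) (level (suc k)) (λ x y → ⟦ x ⋖ y ⟧ * m y)

    -- Counted from the upper level, y hands out `down y * m y`: its own weight plus the loss, which
    -- is at most 2 / (nH) as up y ≥ n/2. There are at most N such y.
    n*∑U′ : n * ∑ (level k) U′ ≤ E * M * (n * ∑ (level (suc k)) U) + N 3 n * (2 * (R * (E * E)))
    n*∑U′ = begin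
      n * ∑ (level k) U′
        ≡⟨ cong (n *_) ∑U′ ⟩
      n * ∑ (level (suc k)) (λ y → ∑ (level k) (λ x → ⟦ x ⋖ y ⟧ * m y))
        ≡⟨ sym (∑-*ˡ n (level (suc k)) (λ y → ∑ (level k) (λ x → ⟦ x ⋖ y ⟧ * m y))) ⟩
      ∑ (level (suc k)) (λ y → n * ∑ (level k) (λ x → ⟦ x ⋖ y ⟧ * m y))
        ≤⟨ ∑-mono (level (suc k)) (λ {y} → term y) ⟩
      ∑ (level (suc k)) (λ y → E * M * (n * U y) + 2 * (R * (E * E)))
        ≡⟨ ∑-+ (level (suc k)) (λ y → E * M * (n * U y)) (λ _ → 2 * (R * (E * E))) ⟩
      ∑ (level (suc k)) (λ y → E * M * (n * U y)) + ∑ (level (suc k)) (λ _ → 2 * (R * (E * E)))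
        ≡⟨ cong₂ _+_ (trans (∑-*ˡ (E * M) (level (suc k)) (λ y → n * U y)) (cong (E * M *_) (∑-*ˡ n (level (suc k)) U)))
                     (∑-const (level (suc k)) _) ⟩
      E * M * (n * ∑ (level (suc k)) U) + length (level (suc k)) * (2 * (R * (E * E)))
        ≤⟨ +-monoʳ-≤ (E * M * (n * ∑ (level (suc k)) U)) (*-monoˡ-≤ (2 * (R * (E * E))) (length-level≤N 1+k≤2n)) ⟩
      E * M * (n * ∑ (level (suc k)) U) + N 3 n * (2 * (R * (E * E))) ∎
      where
      1+k≤2n : suc k ≤ 2 * n
      1+k≤2n = ≤-trans (subst (suc k ≤_) 1+k+i≡n (m≤m+n (suc k) i)) (m≤m+n n _)
      e : ∀ n U EM R q E → n * (U * EM + R * q * E) ≡ EM * (n * U) + R * (n * q) * E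
      e = solve-∀
      e′ : ∀ R E → R * (2 * E) * E ≡ 2 * (R * (E * E))
      e′ = solve-∀
      term : ∀ y → y ∈ level (suc k) → n * ∑ (level k) (λ x → ⟦ x ⋖ y ⟧ * m y) ≤ E * M * (n * U y) + 2 * (R * (E * E))
      term y y∈ = begin
        n * ∑ (level k) (λ x → ⟦ x ⋖ y ⟧ * m y)
          ≡⟨ cong (n *_) (trans (∑-cong (level k) (λ x → *-comm ⟦ x ⋖ y ⟧ (m y)))
               (trans (∑-*ˡ (m y) (level k) (λ x → ⟦ x ⋖ y ⟧)) (trans (*-comm (m y) _) (cong (_* m y) (down-degree y∈))))) ⟩
        n * (down y * m y)                                  ≡⟨ cong (n *_) (down*m y∈) ⟩
        n * (U y * (E * M) + R * q (up y) * E)              ≡⟨ e n (U y) (E * M) R (q (up y)) E ⟩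
        E * M * (n * U y) + R * (n * q (up y)) * E          ≤⟨ +-monoʳ-≤ (E * M * (n * U y)) (*-monoˡ-≤ E (*-monoʳ-≤ R (n*q-up y∈))) ⟩
        E * M * (n * U y) + R * (2 * E) * E                 ≡⟨ cong (E * M * (n * U y) +_) (e′ R E) ⟩
        E * M * (n * U y) + 2 * (R * (E * E))               ∎

    total′ : H * (n * ∑ (level k) U′) + 2 * (R * (E * M) * N 3 n) ≤ H * (R * (E * M) * N 3 n * (n + 6))
    total′ = begin
      H * (n * ∑ (level k) U′) + 2 * (R * (E * M) * N 3 n)
        ≤⟨ +-monoˡ-≤ (2 * (R * (E * M) * N 3 n)) (*-monoʳ-≤ H n*∑U′) ⟩
      H * (E * M * Y + N 3 n * (2 * (R * (E * E)))) + 2 * (R * (E * M) * N 3 n)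
        ≡⟨ e₁ E h R (N 3 n) Y ⟩
      -- The loss 2 / (nH) and the slack 2 / (nH) still to be kept add up to the previous slack 2 /
      -- (nh), since H = 2h.
      2 * (E * M) * (h * Y + 2 * (R * N 3 n))
        ≤⟨ *-monoʳ-≤ (2 * (E * M)) total ⟩
      2 * (E * M) * (h * (R * N 3 n * (n + 6)))
        ≡⟨ e₂ (E * M) h R (N 3 n) n ⟩
      H * (R * (E * M) * N 3 n * (n + 6)) ∎
      where
      h = 2 ^ i
      Y = n * ∑ (level (suc k)) U
      e₁ : ∀ E h R N T → 2 * h * (E * (E * (2 * h)) * T + N * (2 * (R * (E * E)))) + 2 * (R * (E * (E * (2 * h))) * N)
                         ≡ 2 * (E * (E * (2 * h))) * (h * T + 2 * (R * N))
      e₁ = solve-∀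
      e₂ : ∀ EM h R N n → 2 * EM * (h * (R * N * (n + 6))) ≡ 2 * h * (R * EM * N * (n + 6))
      e₂ = solve-∀

  below-middle : 1 ≤ n → ∀ i k → k + i ≡ n → Lower (i + suc n) k i
  below-middle 1≤n zero    k eq = subst (λ k → Lower (suc n) k 0) (trans (sym eq) (+-identityʳ k)) (lower-start 1≤n)
  below-middle 1≤n (suc i) k eq = lower-step eq (below-middle 1≤n i (suc k) (trans (sym (+-suc k i)) eq))

  -- From the weights on level 0 to the number of antichains.

  α^n≤2^[N*[n+6]] : 1 ≤ n → α 3 n ^ n ≤ 2 ^ (N 3 n * (n + 6))
  α^n≤2^[N*[n+6]] 1≤n = ^-cancelˡ-≤ R {{R≢0}} (begin
    (α 3 n ^ n) ^ R                    ≡⟨ trans (^-*-assoc (α 3 n) n R) (trans (cong (α 3 n ^_) (*-comm n R)) (sym (^-*-assoc (α 3 n) R n))) ⟩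
    (α 3 n ^ R) ^ n                    ≤⟨ ^-monoˡ-≤ n (^-monoˡ-≤ R α≤extensions) ⟩
    (extensions (suc (2 * n)) 0 [] ^ R) ^ n
      -- The 2n + 1 levels are the n below the middle and the n + 1 from the middle up.
      ≡⟨ cong (λ j → (extensions j 0 [] ^ R) ^ n) (trans (cong (λ z → suc (n + z)) (+-identityʳ n)) (sym (+-suc n n))) ⟩
    (extensions (n + suc n) 0 [] ^ R) ^ n   ≤⟨ ^-monoˡ-≤ n (bound upper []) ⟩
    (2 ^ ∑ (filterᵇ (allowed []) (level 0)) U) ^ n   ≤⟨ ^-monoˡ-≤ n (^-monoʳ-≤ 2 (∑-filterᵇ-≤ (allowed []) (level 0) U)) ⟩
    (2 ^ ∑ (level 0) U) ^ n                ≡⟨ ^-*-assoc 2 (∑ (level 0) U) n ⟩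
    2 ^ (∑ (level 0) U * n)                ≡⟨ cong (2 ^_) (*-comm (∑ (level 0) U) n) ⟩
    2 ^ (n * ∑ (level 0) U)                ≤⟨ ^-monoʳ-≤ 2 (*-cancelˡ-≤ (2 ^ n) {{m^n≢0 2 n}} (≤-trans (m≤m+n _ _) total)) ⟩
    2 ^ (R * N 3 n * (n + 6))          ≡⟨ cong (2 ^_) (e R (N 3 n) (n + 6)) ⟩
    2 ^ (N 3 n * (n + 6) * R)          ≡⟨ sym (^-*-assoc 2 (N 3 n * (n + 6)) R) ⟩
    (2 ^ (N 3 n * (n + 6))) ^ R        ∎)
    where
    open ≤-Reasoning
    open Lower (below-middle 1≤n n 0 refl)
    e : ∀ a b c → a * b * c ≡ b * c * a
    e = solve-∀

theorem1p4 : (n : ℕ) → 1 ≤ n →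
    α 3 n ^ n ≤ 2 ^ (n * N 3 n) * 3 ^ (4 * N 3 n)
theorem1p4 n 1≤n = begin
  α 3 n ^ n                              ≤⟨ α^n≤2^[N*[n+6]] 1≤n ⟩
  2 ^ (N 3 n * (n + 6))                  ≡⟨ cong (2 ^_) (e (N 3 n) n) ⟩
  2 ^ (n * N 3 n + 6 * N 3 n)            ≡⟨ ^-distribˡ-+-* 2 (n * N 3 n) (6 * N 3 n) ⟩
  2 ^ (n * N 3 n) * 2 ^ (6 * N 3 n)      ≡⟨ cong (2 ^ (n * N 3 n) *_) (sym (^-*-assoc 2 6 (N 3 n))) ⟩
  2 ^ (n * N 3 n) * 64 ^ N 3 n           ≤⟨ *-monoʳ-≤ (2 ^ (n * N 3 n)) (^-monoˡ-≤ (N 3 n) (m≤m+n 64 17)) ⟩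
  2 ^ (n * N 3 n) * 81 ^ N 3 n           ≡⟨ cong (2 ^ (n * N 3 n) *_) (^-*-assoc 3 4 (N 3 n)) ⟩
  2 ^ (n * N 3 n) * 3 ^ (4 * N 3 n)      ∎
  where
  open ≤-Reasoning
  e : ∀ N n → N * (n + 6) ≡ n * N + 6 * N
  e = solve-∀
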